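{- Let $\mathcal T$ be a theory in which satisfiability of $\forall^*\exists^*$ formulas is decidable. Then the synthesis problem is solvable for lookback-free properties $\psi\in\mathcal L$. That is: - realizability of $\psi$ is decidable (by checking satisfiability of $\mathit{Win}(\mathcal{AO}_\psi)$); - whenever $\psi$ is realizable, the strategy $g$ realizes $\psi$.
   Context: Syntax. Fix a multi-sorted first-order signature $\Sigma=\langle\mathcal S,\mathcal P,\mathcal F,V\rangle$: - $\mathcal S$ is a set of sorts containing $\mathit{bool}$; - $\mathcal P$ and $\mathcal F$ are sorted predicate and function symbols, and equality is the identity; - $V$ is a finite non-empty set of sorted data variables. Each $v\in V$ has a lookback variable $\overleftarrow v$, and $\overleftarrow V=\{\overleftarrow v\mid v\in V\}$. Terms are $t::=v\mid\overleftarrow v\mid f(t_1,\dots,t_k)$; atoms are $p(t_1,\dots,t_k)$. First-order formulas are $\phi::=\top\mid\bot\mid a\mid\neg a\mid\phi_1\wedge\phi_2\mid\phi_1\vee\phi_2$. Properties are $\psi::=\phi\mid\psi_1\wedge\psi_2\mid\psi_1\vee\psi_2\mid\mathsf X\psi\mid\mathsf X_{\mathsf w}\psi\mid\psi_1\mathsf U\psi_2\mid\psi_1\mathsf R\psi_2$, forming the set $\mathcal L$. A property is lookback-free if no lookback variable occurs in it. A theory $\mathcal T$ is a set of closed (possibly quantified) $\Sigma$-formulas. Semantics. A trace is $\tau=(M,\langle\alpha_0,\dots,\alpha_{n-1}\rangle)$, with $M$ a $\Sigma$-structure and the $\alpha_i$ assignments on $V$. A term is well-defined at $i$ if $0<i<n$,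 or $i=0$ and it has no lookback variable. $v$ evaluates to $\alpha_i(v)$ and $\overleftarrow v$ to $\alpha_{i-1}(v)$. - An atom holds at $i$ iff some argument is not well-defined or the predicate holds of the evaluated arguments; $\neg a$ holds iff $a$ does not. - $\wedge$ and $\vee$ are as usual. - $\mathsf X\psi$: $i<n-1$ and $\psi$ holds at $i+1$. - $\mathsf X_{\mathsf w}\psi$: $i=n-1$ or $\psi$ holds at $i+1$. - $\psi_1\mathsf U\psi_2$: some $j\in[i,n)$ has $\psi_2$ and all $k\in[i,j)$ have $\psi_1$. - $\psi_1\mathsf R\psi_2$: either $\psi_2$ holds at all $j\in[i,n)$, or some $j\in[i,n)$ has $\psi_1$ and all $k\in[i,j]$ have $\psi_2$. $\tau\models\psi$ iff $\psi$ holds at $0$. Normal forms and decomposition. - $\mathit{last}$ is a proposition holding at the last instant. - $\mathsf{tnps}(\psi)=\{\psi\}$ for (negated) atoms and temporally-rooted $\psi$, and is the union over $\wedge$ and $\vee$. - $\mathsf{xnf}$ fixes literals, $\top$, $\bot$ and $\mathsf X$/$\mathsf X_{\mathsf w}$-rooted properties, commutes with $\wedge$ and $\vee$, and satisfies $\mathsf{xnf}(\psi_1\mathsf U\psi_2)=\mathsf{xnf}(\psi_2)\vee(\mathsf{xnf}(\psi_1)\wedge\mathsf X(\psi_1\mathsf U\psi_2))$ and $\mathsf{xnf}(\psi_1\mathsf R\psi_2)=(\mathsf{xnf}(\psi_2)\vee\mathit{last})\wedge(\mathsf{xnf}(\psi_1)\vee\mathsf X_{\mathsf w}(\psi_1\mathsf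 R\psi_2))$. - $\mathsf{rmX}$ maps $\bot,\top,\mathit{last},\neg\mathit{last}$ to $\bot,\top,\bot,\top$, maps $\mathsf X\psi\mapsto\psi\wedge\neg\mathit{last}$ and $\mathsf X_{\mathsf w}\psi\mapsto\psi\vee\mathit{last}$, and commutes with $\wedge$ and $\vee$. - $\equiv$ is propositional equivalence, treating atoms, $\mathit{last}$ and temporally-rooted subproperties as opaque propositions. - For $\psi$ in XNF and a set of atoms $C$, $\mathsf{decomp}(\psi,C)=\{(\mathsf{prm}_i,\mathsf{sub}_i)\}_{i\le k}$ is a fixed decomposition such that: $\psi\equiv\bigvee_i(\mathsf{prm}_i\wedge\mathsf{sub}_i)$; each $\mathsf{prm}_i$ is temporal-free with atoms in $C$; $\mathsf{tnps}(\mathsf{sub}_i)\cap C=\emptyset$; the $\mathsf{prm}_i$ are pairwise propositionally disjoint with disjunction $\equiv\top$; and the $\mathsf{sub}_i$ are pairwise distinct. AND-OR-graph. $V=X\uplus Y$, with $X$ the environment variables and $Y$ the agent variables. $C_{\mathit{env}}$ is the set of atoms of $\psi$ without $Y$-variables, and $C_{\mathit{ag}}$ is the rest of the atoms of $\psi$. $\mathcal{AO}_\psi$ is built as follows: - The initial AND-node $s_0$ is labelled $\psi$. - For each AND-node $s$ labelled $\psi'\ne\top$ and each $(\mathsf{prm}_i,\mathsf{sub}_i)\in\mathsf{decomp}(\mathsf{xnf}(\psi'),C_{\mathit{env}})$, there is an OR-node $n_i$ with an edge $s\xrightarrow{\mathsf{prm}_i}n_i$. - For each $(\mathsf{prm}_{i,j},\mathsf{sub}_{i,j})\in\mathsf{decomp}(\mathsf{xnf}(\mathsf{sub}_i),C_{\mathit{ag}})$,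 there is an AND-node labelled $\mathsf{xnf}(\mathsf{rmX}(\mathsf{sub}_{i,j}))$ with an edge $n_i\xrightarrow{\mathsf{prm}_{i,j}}$ to it. - AND-nodes with equal labels are shared; the node labelled $\top$ is final. Winning formulas. - For an OR-node $t$ with edges $t\xrightarrow{\varsigma_j}s_j$: $\mathit{Pre}'_{\mathcal C}(t)=\bigvee_j\exists Y.(\varsigma_j\wedge\mathcal C(s_j))$. - For an AND-node $s$ with edges $s\xrightarrow{w_i}t_i$: $\mathit{Pre}_{\mathcal C}(s)=\bigwedge_i(\forall X.(w_i\to\mathit{Pre}'_{\mathcal C}(t_i)))[\overleftarrow V/V]$, where each $\overleftarrow v$ is renamed to $v$. - $\mathit{Win}_0(s)=\top$ if $s$ is final and $\bot$ otherwise; $\mathit{Win}_{i+1}(s)=\mathit{Win}_i(s)\vee\mathit{Pre}_{\mathit{Win}_i}(s)$. - $\mathit{Win}(\mathcal{AO}_\psi)=\bigvee_i\mathit{Win}_i(s_0)$, defined when $\mathit{Win}_K(s_0)=\mathit{Win}_{K+1}(s_0)$ for some $K$. Synthesis. The environment chooses $\beta_0,\beta_1,\ldots\in[X]$ (assignments with domain $X$ into a $\mathcal T$-model $M$). A strategy $h:[X]^*\to[Y]$ realizes $\psi$ if for every infinite $\pi=\beta_0\beta_1\cdots$ there is $k$ such that $\langle\beta_0\cup h(\pi|_1),\dots,\beta_k\cup h(\pi|_{k+1})\rangle\models\psi$, where $\pi|_k$ is the prefix of length $k$. Realizability asks whether such a strategy exists. Strategy $g$. Assume $\mathit{Win}_K(s_0)=\mathit{Win}_{K+1}(s_0)$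 is satisfied by the $\mathcal T$-model $M$. For each $\pi$, define the following by induction on $k$: - $\eta_0=\beta_0$; for $k>0$, $\eta_k=\beta_k\cup\overleftarrow\beta_{k-1}\cup\overleftarrow\gamma_{k-1}$ with $\gamma_{k-1}=g(\pi|_k)$. - From $s_k$ (starting at $s_0$), follow the unique edge $s_k\xrightarrow{w}t$ with $M,\eta_k\models w$. - Choose an edge $t\xrightarrow{\varsigma_j}u_j$ such that $\eta_k(\varsigma_j\wedge\mathit{Win}_{K-k}(u_j))$ is satisfiable in $M$; let $g(\pi|_{k+1})$ satisfy it and set $s_{k+1}=u_j$. - Stop (with $\mathit{len}=k+1$) when $s_{k+1}$ is final. Solvable. The synthesis problem is solvable for a class of properties if realizability is decidable for them and the strategy $g$ realizes every realizable property in the class.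
   Formalization: A node is final when its label becomes ⊤ once last holds (with only ⊤ final, X_w ⊥ is realizable but Win is ⊥); K must make Win_K(s_0) equivalent to the whole disjunction, not only to Win_{K+1}(s_0) (cf. X X ⊤); sub_i has no atom of C, negated or not. -}

module Defs where

open import Axiom.ExcludedMiddle using (ExcludedMiddle)
open import Data.Bool.Base using (Bool; true; false; T; not; _∧_; _∨_; if_then_else_)
open import Data.Bool.Properties using (T?) renaming (_≟_ to _≟ᵇ_)
open import Data.Empty using (⊥)
open import Data.Fin.Base as Fin using (Fin; toℕ; inject₁)
open import Data.List.Base using (List; []; _∷_; _++_; map; foldr; filter; applyUpTo)
open import Data.List.Membership.Propositional using (_∈_; _∉_)
open import Data.List.Membership.Propositional.Properties using (∈-++⁺ˡ; ∈-++⁺ʳ; ∈-++⁻; ∈-map⁺; ∈-filter⁺; ∈-filter⁻)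
open import Data.List.Properties using () renaming (≡-dec to list-dec)
open import Data.List.Relation.Unary.All as All using (All; []; _∷_)
open import Data.List.Relation.Unary.All.Properties using (++⁺)
open import Data.List.Relation.Unary.AllPairs using (AllPairs)
open import Data.List.Relation.Unary.Any using (here; there)
open import Data.List.Relation.Unary.Unique.Propositional using (Unique)
open import Data.Maybe.Base using (Maybe; just; nothing; maybe; zipWith) renaming (map to mapMaybe)
open import Data.Nat.Base using (ℕ; zero; suc; _∸_)
open import Data.Product.Base using (Σ; Σ-syntax; ∃; ∃-syntax; _×_; _,_; proj₁; proj₂; uncurry)
open import Data.Sum.Base using (_⊎_; inj₁; inj₂)
open import Data.Unit.Base using (⊤; tt)
open import Function.Base using (_∘_)
open import Level using (0ℓ) renaming (suc to lsuc)
open import Relation.Binary.Definitions using (DecidableEquality)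
open import Relation.Binary.PropositionalEquality using (_≡_; refl; sym; trans; cong; cong₂; subst)
open import Relation.Nullary using (¬_; Dec; yes; no; does; Reflects)
open import Relation.Nullary.Decidable using (map′; _×-dec_; dec-true; dec-false)

Classical : Set₂
Classical = ExcludedMiddle (lsuc 0ℓ)

-- The metatheory of first-order satisfiability is classical, but under
-- excluded middle "Dec (P a) for all a" says nothing.  So the procedure
-- itself is given without excluded middle, which only its correctness
-- proof may use.
Decidable : {A : Set} → (A → Set₁) → Set₂
Decidable {A} P = Σ[ d ∈ (A → Bool) ] (Classical → ∀ a → Reflects (P a) (d a))

record Signature : Set₁ where
  field
    Sort : Set
    bool : Sort
    Pred : List Sort → Set
    Fun  : List Sort → Sort → Set
    _≟ˢ_ : DecidableEquality Sort
    _≟ᵖ_ : ∀ {ss} → DecidableEquality (Pred ss)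
    _≟ᶠ_ : ∀ {ss s} → DecidableEquality (Fun ss s)

module Logic (S : Signature) where
  open Signature S public

  Ctx : Set
  Ctx = List Sort

  data Term (Var : Sort → Set) : Sort → Set where
    var : ∀ {s} → Var s → Term Var s
    app : ∀ {ss s} → Fun ss s → All (Term Var) ss → Term Var s

  infix 8 _≐_
  data Atom (Var : Sort → Set) : Set where
    rel : ∀ {ss} → Pred ss → All (Term Var) ss → Atom Var
    _≐_ : ∀ {s} → Term Var s → Term Var s → Atom Var

  module _ {Var Var′ : Sort → Set} (f : ∀ {s} → Var s → Var′ s) where
    mapTerm  : ∀ {s} → Term Var s → Term Var′ s
    mapTerms : ∀ {ss} → All (Term Var) ss → All (Term Var′) ss
    mapTerm (var x)    = var (f x)
    mapTerm (app g ts) = app g (mapTerms ts)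
    mapTerms []       = []
    mapTerms (t ∷ ts) = mapTerm t ∷ mapTerms ts

    mapAtom : Atom Var → Atom Var′
    mapAtom (rel p ts) = rel p (mapTerms ts)
    mapAtom (t ≐ u)    = mapTerm t ≐ mapTerm u

  module _ {Var : Sort → Set} (f : ∀ {s} → Var s → Bool) where
    allVars   : ∀ {s} → Term Var s → Bool
    allVarses : ∀ {ss} → All (Term Var) ss → Bool
    allVars (var x)    = f x
    allVars (app g ts) = allVarses ts
    allVarses []       = true
    allVarses (t ∷ ts) = allVars t ∧ allVarses ts

    allVarsᵃ : Atom Var → Bool
    allVarsᵃ (rel p ts) = allVarses ts
    allVarsᵃ (t ≐ u)    = allVars t ∧ allVars u

  module _ {Var : Sort → Set} (_≟_ : ∀ {s} → DecidableEquality (Var s)) where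
    term-dec  : ∀ {s} → DecidableEquality (Term Var s)
    terms-dec : ∀ {ss} → DecidableEquality (All (Term Var) ss)
    term-dec (var x) (var y) = map′ (cong var) (λ { refl → refl }) (x ≟ y)
    term-dec (var x) (app g us) = no λ ()
    term-dec (app f ts) (var y) = no λ ()
    term-dec (app {ss} f ts) (app {ss′} g us) with list-dec _≟ˢ_ ss ss′
    ... | no ss≢   = no λ { refl → ss≢ refl }
    ... | yes refl = map′ (λ { (refl , refl) → refl }) (λ { refl → refl , refl })
                          ((f ≟ᶠ g) ×-dec terms-dec ts us)
    terms-dec [] [] = yes refl
    terms-dec (t ∷ ts) (u ∷ us) =
      map′ (uncurry (cong₂ _∷_)) (λ { refl → refl , refl })
           (term-dec t u ×-dec terms-dec ts us)

    atom-dec : DecidableEquality (Atom Var)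
    atom-dec (rel {ss} p ts) (rel {ss′} q us) with list-dec _≟ˢ_ ss ss′
    ... | no ss≢   = no λ { refl → ss≢ refl }
    ... | yes refl = map′ (λ { (refl , refl) → refl }) (λ { refl → refl , refl })
                          ((p ≟ᵖ q) ×-dec terms-dec ts us)
    atom-dec (rel p ts) (t ≐ u) = no λ ()
    atom-dec (t ≐ u) (rel p ts) = no λ ()
    atom-dec (_≐_ {s} t u) (_≐_ {s′} t′ u′) with s ≟ˢ s′
    ... | no s≢    = no λ { refl → s≢ refl }
    ... | yes refl = map′ (λ { (refl , refl) → refl }) (λ { refl → refl , refl })
                          (term-dec t t′ ×-dec term-dec u u′)

  infixr 7 _∧′_
  infixr 6 _∨′_
  infixr 5 _⇒′_
  data Formula (Γ : Ctx) : Set where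
    ⊤′ ⊥′          : Formula Γ
    atom′          : Atom (_∈ Γ) → Formula Γ
    ¬′_            : Formula Γ → Formula Γ
    _∧′_ _∨′_ _⇒′_ : Formula Γ → Formula Γ → Formula Γ
    ∀′ ∃′          : ∀ s → Formula (s ∷ Γ) → Formula Γ

  Sentence : Set
  Sentence = Formula []

  Theory : Set₁
  Theory = Sentence → Set

  ⋀′ ⋁′ : ∀ {Γ} → List (Formula Γ) → Formula Γ
  ⋀′ = foldr _∧′_ ⊤′
  ⋁′ = foldr _∨′_ ⊥′

  ∀[_] ∃[_]′ : ∀ Δ {Γ} → Formula (Δ ++ Γ) → Formula Γ
  ∀[ [] ] φ     = φ
  ∀[ s ∷ Δ ] φ  = ∀[ Δ ] (∀′ s φ)
  ∃[ [] ]′ φ    = φ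
  ∃[ s ∷ Δ ]′ φ = ∃[ Δ ]′ (∃′ s φ)

  Renaming : Ctx → Ctx → Set
  Renaming Γ Δ = ∀ {s} → s ∈ Γ → s ∈ Δ

  lift : ∀ {Γ Δ s} → Renaming Γ Δ → Renaming (s ∷ Γ) (s ∷ Δ)
  lift r (here p)  = here p
  lift r (there x) = there (r x)

  rename : ∀ {Γ Δ} → Renaming Γ Δ → Formula Γ → Formula Δ
  rename r ⊤′        = ⊤′
  rename r ⊥′        = ⊥′
  rename r (atom′ a) = atom′ (mapAtom r a)
  rename r (¬′ φ)    = ¬′ rename r φ
  rename r (φ ∧′ χ)  = rename r φ ∧′ rename r χ
  rename r (φ ∨′ χ)  = rename r φ ∨′ rename r χ
  rename r (φ ⇒′ χ)  = rename r φ ⇒′ rename r χ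
  rename r (∀′ s φ)  = ∀′ s (rename (lift r) φ)
  rename r (∃′ s φ)  = ∃′ s (rename (lift r) φ)

  QuantifierFree : ∀ {Γ} → Formula Γ → Set
  QuantifierFree ⊤′        = ⊤
  QuantifierFree ⊥′        = ⊤
  QuantifierFree (atom′ a) = ⊤
  QuantifierFree (¬′ φ)    = QuantifierFree φ
  QuantifierFree (φ ∧′ χ)  = QuantifierFree φ × QuantifierFree χ
  QuantifierFree (φ ∨′ χ)  = QuantifierFree φ × QuantifierFree χ
  QuantifierFree (φ ⇒′ χ)  = QuantifierFree φ × QuantifierFree χ
  QuantifierFree (∀′ s φ)  = ⊥
  QuantifierFree (∃′ s φ)  = ⊥

  data ∃* {Γ} : Formula Γ → Set where
    matrix : ∀ {φ} → QuantifierFree φ → ∃* φ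
    ∃-step : ∀ {s φ} → ∃* φ → ∃* (∃′ s φ)

  data ∀*∃* {Γ} : Formula Γ → Set where
    ∃-part : ∀ {φ} → ∃* φ → ∀*∃* φ
    ∀-step : ∀ {s φ} → ∀*∃* φ → ∀*∃* (∀′ s φ)

  record Structure : Set₁ where
    field
      Carrier   : Sort → Set
      inhabited : ∀ s → Carrier s
      ⟦_⟧ᶠ      : ∀ {ss s} → Fun ss s → All Carrier ss → Carrier s
      ⟦_⟧ᵖ      : ∀ {ss} → Pred ss → All Carrier ss → Set

  module _ (M : Structure) where
    open Structure M

    Env : Ctx → Set
    Env = All Carrier

    module _ {Var : Sort → Set} (ρ : ∀ {s} → Var s → Carrier s) where
      ⟦_⟧  : ∀ {s} → Term Var s → Carrier s
      ⟦_⟧* : ∀ {ss} → All (Term Var) ss → All Carrier ss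
      ⟦ var x ⟧    = ρ x
      ⟦ app f ts ⟧ = ⟦ f ⟧ᶠ ⟦ ts ⟧*
      ⟦ [] ⟧*     = []
      ⟦ t ∷ ts ⟧* = ⟦ t ⟧ ∷ ⟦ ts ⟧*

      HoldsAtom : Atom Var → Set
      HoldsAtom (rel p ts) = ⟦ p ⟧ᵖ ⟦ ts ⟧*
      HoldsAtom (t ≐ u)    = ⟦ t ⟧ ≡ ⟦ u ⟧

    -- A term has a value only if all its variables have one; an atom
    -- with an undefined argument holds.
    module _ {Var : Sort → Set} (ρ : ∀ {s} → Var s → Maybe (Carrier s)) where
      ⟦_⟧?  : ∀ {s} → Term Var s → Maybe (Carrier s)
      ⟦_⟧*? : ∀ {ss} → All (Term Var) ss → Maybe (All Carrier ss)
      ⟦ var x ⟧?    = ρ x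
      ⟦ app f ts ⟧? = mapMaybe ⟦ f ⟧ᶠ ⟦ ts ⟧*?
      ⟦ [] ⟧*?     = just []
      ⟦ t ∷ ts ⟧*? = zipWith _∷_ ⟦ t ⟧? ⟦ ts ⟧*?

      HoldsAtom? : Atom Var → Set
      HoldsAtom? (rel p ts) = maybe ⟦ p ⟧ᵖ ⊤ ⟦ ts ⟧*?
      HoldsAtom? (t ≐ u)    = maybe (uncurry _≡_) ⊤ (zipWith _,_ ⟦ t ⟧? ⟦ u ⟧?)

    infix 4 _⊨_
    _⊨_ : ∀ {Γ} → Env Γ → Formula Γ → Set
    ρ ⊨ ⊤′       = ⊤
    ρ ⊨ ⊥′       = ⊥
    ρ ⊨ atom′ a  = HoldsAtom (All.lookup ρ) a
    ρ ⊨ ¬′ φ     = ¬ (ρ ⊨ φ)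
    ρ ⊨ φ ∧′ χ   = (ρ ⊨ φ) × (ρ ⊨ χ)
    ρ ⊨ φ ∨′ χ   = (ρ ⊨ φ) ⊎ (ρ ⊨ χ)
    ρ ⊨ φ ⇒′ χ   = ρ ⊨ φ → ρ ⊨ χ
    ρ ⊨ ∀′ s φ   = (x : Carrier s) → (x ∷ ρ) ⊨ φ
    ρ ⊨ ∃′ s φ   = Σ[ x ∈ Carrier s ] ((x ∷ ρ) ⊨ φ)

    ModelOf : Theory → Set
    ModelOf 𝒯 = ∀ φ → 𝒯 φ → [] ⊨ φ

    Satisfies : ∀ {Γ} → Formula Γ → Set
    Satisfies {Γ} φ = ∃[ ρ ] _⊨_ {Γ} ρ φ

  Satisfiable : Theory → ∀ {Γ} → Formula Γ → Set₁
  Satisfiable 𝒯 φ = Σ[ M ∈ Structure ] (ModelOf M 𝒯 × Satisfies M φ)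

infixr 7 _∧ᵇ_
infixr 6 _∨ᵇ_
data Boolean (A : Set) : Set where
  ttᵇ ffᵇ   : Boolean A
  posᵇ negᵇ : A → Boolean A
  _∧ᵇ_ _∨ᵇ_ : Boolean A → Boolean A → Boolean A

infixr 7 _and_
infixr 6 _or_
infixr 8 _until_ _release_
data LTL (A : Set) : Set where
  tt ff                : LTL A
  pos neg              : A → LTL A
  _and_ _or_           : LTL A → LTL A → LTL A
  next wnext           : LTL A → LTL A
  _until_ _release_    : LTL A → LTL A → LTL A

module _ {A B : Set} (f : A → B) where
  fromBoolean : Boolean A → LTL B
  fromBoolean ttᵇ      = tt
  fromBoolean ffᵇ      = ff
  fromBoolean (posᵇ a) = pos (f a)
  fromBoolean (negᵇ a) = neg (f a)
  fromBoolean (φ ∧ᵇ χ) = fromBoolean φ and fromBoolean χ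
  fromBoolean (φ ∨ᵇ χ) = fromBoolean φ or fromBoolean χ

  mapLTL : LTL A → LTL B
  mapLTL tt            = tt
  mapLTL ff            = ff
  mapLTL (pos a)       = pos (f a)
  mapLTL (neg a)       = neg (f a)
  mapLTL (φ and χ)     = mapLTL φ and mapLTL χ
  mapLTL (φ or χ)      = mapLTL φ or mapLTL χ
  mapLTL (next φ)      = next (mapLTL φ)
  mapLTL (wnext φ)     = wnext (mapLTL φ)
  mapLTL (φ until χ)   = mapLTL φ until mapLTL χ
  mapLTL (φ release χ) = mapLTL φ release mapLTL χ

-- A valuation is consulted only at positive literals and at
-- temporally-rooted properties, the opaque propositions.
Valuation : Set → Set
Valuation A = LTL A → Bool

module _ {A : Set} where
  atomsᵇ : Boolean A → List A
  atomsᵇ ttᵇ      = []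
  atomsᵇ ffᵇ      = []
  atomsᵇ (posᵇ a) = a ∷ []
  atomsᵇ (negᵇ a) = a ∷ []
  atomsᵇ (φ ∧ᵇ χ) = atomsᵇ φ ++ atomsᵇ χ
  atomsᵇ (φ ∨ᵇ χ) = atomsᵇ φ ++ atomsᵇ χ

  atoms : LTL A → List A
  atoms tt            = []
  atoms ff            = []
  atoms (pos a)       = a ∷ []
  atoms (neg a)       = a ∷ []
  atoms (φ and χ)     = atoms φ ++ atoms χ
  atoms (φ or χ)      = atoms φ ++ atoms χ
  atoms (next φ)      = atoms φ
  atoms (wnext φ)     = atoms φ
  atoms (φ until χ)   = atoms φ ++ atoms χ
  atoms (φ release χ) = atoms φ ++ atoms χ

  ⋁ : List (LTL A) → LTL A
  ⋁ = foldr _or_ ff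

  tnps : LTL A → List (LTL A)
  tnps tt        = []
  tnps ff        = []
  tnps (φ and χ) = tnps φ ++ tnps χ
  tnps (φ or χ)  = tnps φ ++ tnps χ
  tnps φ         = φ ∷ []

  value : Valuation A → LTL A → Bool
  value ν tt        = true
  value ν ff        = false
  value ν (pos a)   = ν (pos a)
  value ν (neg a)   = not (ν (pos a))
  value ν (φ and χ) = value ν φ ∧ value ν χ
  value ν (φ or χ)  = value ν φ ∨ value ν χ
  value ν φ         = ν φ

  infix 4 _≡ₚ_
  _≡ₚ_ : LTL A → LTL A → Set
  φ ≡ₚ χ = ∀ (ν : Valuation A) → value ν φ ≡ value ν χ

  XNF : LTL A → Set
  XNF tt            = ⊤
  XNF ff            = ⊤
  XNF (pos a)       = ⊤
  XNF (neg a)       = ⊤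
  XNF (φ and χ)     = XNF φ × XNF χ
  XNF (φ or χ)      = XNF φ × XNF χ
  XNF (next φ)      = ⊤
  XNF (wnext φ)     = ⊤
  XNF (φ until χ)   = ⊥
  XNF (φ release χ) = ⊥

module WithLast {A : Set} (_≟_ : DecidableEquality A) where

  data Proposition : Set where
    atom : A → Proposition
    last : Proposition

  Label : Set
  Label = LTL Proposition

  xnf : Label → Label
  xnf (φ and χ)     = xnf φ and xnf χ
  xnf (φ or χ)      = xnf φ or xnf χ
  xnf (φ until χ)   = xnf χ or (xnf φ and next (φ until χ))
  xnf (φ release χ) = (xnf χ or pos last) and (xnf φ or wnext (φ release χ))
  xnf φ             = φ

  rmX : Label → Label
  rmX (pos last) = ff
  rmX (neg last) = tt
  rmX (next φ)   = φ and neg last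
  rmX (wnext φ)  = φ or pos last
  rmX (φ and χ)  = rmX φ and rmX χ
  rmX (φ or χ)   = rmX φ or rmX χ
  rmX φ          = φ

  -- A successor label is reached when an instant has been completed, and
  -- its `last` (introduced by rmX) says that this instant was the last
  -- one.  Play may stop at a node if stopping there, which makes `last`
  -- true, turns its label into ⊤.  The label itself need not be ⊤: from
  -- wnext ff, which every one-instant trace satisfies, play reaches only
  -- ff or pos last and then ff.
  Final : Label → Set
  Final φ = ∀ (ν : Valuation Proposition) → ν (pos last) ≡ true → value ν φ ≡ true

  private
    _≟ₚ_ : DecidableEquality Proposition
    atom a ≟ₚ atom b = map′ (cong atom) (λ { refl → refl }) (a ≟ b)
    atom a ≟ₚ last   = no λ ()
    last   ≟ₚ atom b = no λ ()
    last   ≟ₚ last   = yes refl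

    open import Data.List.Membership.DecPropositional _≟ₚ_ using (_∈?_)

    sublists : List Proposition → List (List Proposition)
    sublists []       = [] ∷ []
    sublists (p ∷ ps) = map (p ∷_) (sublists ps) ++ sublists ps

    filter∈sublists : (f : Proposition → Bool) (ps : List Proposition) →
                      filter (T? ∘ f) ps ∈ sublists ps
    filter∈sublists f [] = here refl
    filter∈sublists f (p ∷ ps) with f p
    ... | true  = ∈-++⁺ˡ (∈-map⁺ (p ∷_) (filter∈sublists f ps))
    ... | false = ∈-++⁺ʳ (map (p ∷_) (sublists ps)) (filter∈sublists f ps)

    -- Temporally-rooted properties occur only positively, so it suffices
    -- to consider valuations making all of them false.
    row : List Proposition → Valuation Proposition
    row ps (pos last)     = true
    row ps (pos (atom a)) = does (atom a ∈? ps)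
    row ps φ              = false

    ∧-true : ∀ {b c} → b ∧ c ≡ true → (b ≡ true) × (c ≡ true)
    ∧-true {true} eq = refl , eq

    ∨-mono : ∀ {b b′ c c′} → (b ≡ true → b′ ≡ true) → (c ≡ true → c′ ≡ true) →
             b ∨ c ≡ true → b′ ∨ c′ ≡ true
    ∨-mono {true}  f g eq rewrite f refl = refl
    ∨-mono {false} {true}  f g eq = refl
    ∨-mono {false} {false} f g eq = g eq

    ∧-mono : ∀ {b b′ c c′} → (b ≡ true → b′ ≡ true) → (c ≡ true → c′ ≡ true) →
             b ∧ c ≡ true → b′ ∧ c′ ≡ true
    ∧-mono f g eq = cong₂ _∧_ (f (proj₁ (∧-true eq))) (g (proj₂ (∧-true eq)))

    value-mono : ∀ ν ps φ → (∀ {p} → p ∈ atoms φ → row ps (pos p) ≡ ν (pos p)) →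
                 value (row ps) φ ≡ true → value ν φ ≡ true
    value-mono ν ps tt      h eq = refl
    value-mono ν ps (pos p) h eq = trans (sym (h (here refl))) eq
    value-mono ν ps (neg p) h eq = trans (sym (cong not (h (here refl)))) eq
    value-mono ν ps (φ and χ) h =
      ∧-mono (value-mono ν ps φ (h ∘ ∈-++⁺ˡ)) (value-mono ν ps χ (h ∘ ∈-++⁺ʳ (atoms φ)))
    value-mono ν ps (φ or χ) h =
      ∨-mono {value (row ps) φ} (value-mono ν ps φ (h ∘ ∈-++⁺ˡ))
             (value-mono ν ps χ (h ∘ ∈-++⁺ʳ (atoms φ)))
    value-mono ν ps (next φ)      h ()
    value-mono ν ps (wnext φ)     h ()
    value-mono ν ps (φ until χ)   h ()
    value-mono ν ps (φ release χ) h ()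

    row-filter : ∀ (ν : Valuation Proposition) ps → ν (pos last) ≡ true → ∀ {p} → p ∈ ps →
                 row (filter (T? ∘ ν ∘ pos) ps) (pos p) ≡ ν (pos p)
    row-filter ν ps ν-last {last} p∈ = sym ν-last
    row-filter ν ps ν-last {atom a} p∈ with ν (pos (atom a)) in eq
    ... | true  = dec-true (atom a ∈? _)
                    (∈-filter⁺ (T? ∘ ν ∘ pos) p∈ (subst T (sym eq) tt))
    ... | false = dec-false (atom a ∈? _)
                    (λ m → subst T eq (proj₂ (∈-filter⁻ (T? ∘ ν ∘ pos) {xs = ps} m)))

  final? : ∀ φ → Dec (Final φ)
  final? φ = map′ to from (All.all? (λ ps → value (row ps) φ ≟ᵇ true)
                                    (sublists (atoms φ)))
    where
    to : All (λ ps → value (row ps) φ ≡ true) (sublists (atoms φ)) → Final φ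
    to rows ν ν-last =
      value-mono ν _ φ (row-filter ν (atoms φ) ν-last)
        (All.lookup rows (filter∈sublists (ν ∘ pos) (atoms φ)))
    from : Final φ → All (λ ps → value (row ps) φ ≡ true) (sublists (atoms φ))
    from fin = All.tabulate λ {ps} _ → fin (row ps) refl

  record IsDecomposition (ψ : Label) (C : List A) (ds : List (Boolean A × Label)) : Set where
    field
      equivalent : ψ ≡ₚ ⋁ (map (λ (prm , sub) → fromBoolean atom prm and sub) ds)
      prm-atoms  : ∀ {prm sub} → (prm , sub) ∈ ds → ∀ {a} → a ∈ atomsᵇ prm → a ∈ C
      sub-atoms  : ∀ {prm sub} → (prm , sub) ∈ ds → ∀ {a} → a ∈ C →
                   pos (atom a) ∉ tnps sub × neg (atom a) ∉ tnps sub
      disjoint   : AllPairs (λ (prm , _) (prm′ , _) →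
                     (fromBoolean atom prm and fromBoolean atom prm′) ≡ₚ ff) ds
      exhaustive : ⋁ (map (fromBoolean atom ∘ proj₁) ds) ≡ₚ tt
      distinct   : Unique (map proj₂ ds)

  record Decomposition : Set where
    field
      decomp          : Label → List A → List (Boolean A × Label)
      isDecomposition : ∀ {ψ} → XNF ψ → ∀ C → IsDecomposition ψ C (decomp ψ C)

module Properties (S : Signature) (X Y : List (Signature.Sort S)) where
  open Logic S public

  V : Ctx
  V = X ++ Y

  data Variable (s : Sort) : Set where
    current  : s ∈ V → Variable s
    lookback : s ∈ V → Variable s

  ∈-dec : ∀ {s} {Γ : Ctx} → DecidableEquality (s ∈ Γ)
  ∈-dec (here refl) (here refl) = yes refl
  ∈-dec (here _)    (there _)   = no λ ()
  ∈-dec (there _)   (here _)    = no λ ()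
  ∈-dec (there x)   (there y)   = map′ (cong there) (λ { refl → refl }) (∈-dec x y)

  variable-dec : ∀ {s} → DecidableEquality (Variable s)
  variable-dec (current x)  (current y)  = map′ (cong current) (λ { refl → refl }) (∈-dec x y)
  variable-dec (lookback x) (lookback y) = map′ (cong lookback) (λ { refl → refl }) (∈-dec x y)
  variable-dec (current x)  (lookback y) = no λ ()
  variable-dec (lookback x) (current y)  = no λ ()

  PAtom : Set
  PAtom = Atom Variable

  Property : Set
  Property = LTL PAtom

  is-current : ∀ {s} → Variable s → Bool
  is-current (current _)  = true
  is-current (lookback _) = false

  LookbackFree : Property → Set
  LookbackFree ψ = All (T ∘ allVarsᵃ is-current) (atoms ψ)

  -- The value of ←y was fixed one instant earlier, so only y itself
  -- counts as a Y-variable.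
  not-Y : ∀ {s} → Variable s → Bool
  not-Y (lookback _) = true
  not-Y (current x) with ∈-++⁻ X x
  ... | inj₁ _ = true
  ... | inj₂ _ = false

  C-env C-ag : Property → List PAtom
  C-env ψ = filter (λ a → T? (allVarsᵃ not-Y a)) (atoms ψ)
  C-ag  ψ = filter (λ a → T? (not (allVarsᵃ not-Y a))) (atoms ψ)

  patom-dec : DecidableEquality PAtom
  patom-dec = atom-dec (λ {s} → variable-dec {s})

  open WithLast patom-dec public

  module Semantics (M : Structure) where

    valueOf : Maybe (Env M V) → Env M V → ∀ {s} → Variable s → Maybe (Structure.Carrier M s)
    valueOf before now (current x)  = just (All.lookup now x)
    valueOf before now (lookback x) = mapMaybe (λ α → All.lookup α x) before

    -- `before` is absent at the first instant.
    HoldsNow : Maybe (Env M V) → Env M V → PAtom → Set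
    HoldsNow before now = HoldsAtom? M (valueOf before now)

    HoldsBoolean : Maybe (Env M V) → Env M V → Boolean PAtom → Set
    HoldsBoolean b α ttᵇ      = ⊤
    HoldsBoolean b α ffᵇ      = ⊥
    HoldsBoolean b α (posᵇ a) = HoldsNow b α a
    HoldsBoolean b α (negᵇ a) = ¬ HoldsNow b α a
    HoldsBoolean b α (φ ∧ᵇ χ) = HoldsBoolean b α φ × HoldsBoolean b α χ
    HoldsBoolean b α (φ ∨ᵇ χ) = HoldsBoolean b α φ ⊎ HoldsBoolean b α χ

    Trace : ℕ → Set
    Trace n = Fin n → Env M V

    beforeT : ∀ {n} → Trace n → Fin n → Maybe (Env M V)
    beforeT τ Fin.zero    = nothing
    beforeT τ (Fin.suc i) = just (τ (inject₁ i))

    Holds : ∀ {n} → Trace n → Fin n → Property → Set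
    Holds τ i tt        = ⊤
    Holds τ i ff        = ⊥
    Holds τ i (pos a)   = HoldsNow (beforeT τ i) (τ i) a
    Holds τ i (neg a)   = ¬ HoldsNow (beforeT τ i) (τ i) a
    Holds τ i (φ and χ) = Holds τ i φ × Holds τ i χ
    Holds τ i (φ or χ)  = Holds τ i φ ⊎ Holds τ i χ
    Holds τ i (next φ)  = ∃[ j ] (toℕ j ≡ suc (toℕ i) × Holds τ j φ)
    Holds {n} τ i (wnext φ) =
      suc (toℕ i) ≡ n ⊎ ∃[ j ] (toℕ j ≡ suc (toℕ i) × Holds τ j φ)
    Holds τ i (φ until χ) =
      ∃[ j ] (i Fin.≤ j × Holds τ j χ × (∀ k → i Fin.≤ k → k Fin.< j → Holds τ k φ))
    Holds τ i (φ release χ) =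
      (∀ j → i Fin.≤ j → Holds τ j χ) ⊎
      ∃[ j ] (i Fin.≤ j × Holds τ j φ × (∀ k → i Fin.≤ k → k Fin.≤ j → Holds τ k χ))

    _⊨ᵗ_ : ∀ {m} → Trace (suc m) → Property → Set
    τ ⊨ᵗ ψ = Holds τ Fin.zero ψ

    Strategy : Set
    Strategy = List (Env M X) → Env M Y

    module Play (h : Strategy) (π : ℕ → Env M X) where

      play : ℕ → Env M V
      play k = ++⁺ (π k) (h (applyUpTo π (suc k)))

      playBefore : ℕ → Maybe (Env M V)
      playBefore zero    = nothing
      playBefore (suc k) = just (play k)

      prefix : ∀ n → Trace n
      prefix n = play ∘ toℕ

    Realizes : Strategy → Property → Set
    Realizes h ψ = ∀ π → ∃[ k ] (Play.prefix h π (suc k) ⊨ᵗ ψ)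

    RealizableIn : Property → Set
    RealizableIn ψ = ∃[ h ] Realizes h ψ

  Realizable : Theory → Property → Set₁
  Realizable 𝒯 ψ = Σ[ M ∈ Structure ] (ModelOf M 𝒯 × Semantics.RealizableIn M ψ)

module Synthesis (S : Signature) (X Y : List (Signature.Sort S))
                 (D : Properties.Decomposition S X Y) where
  open Properties S X Y public
  open Decomposition D

  -- Formulas at an OR-node live in Y ++ (X ++ V): the current Y and X, and
  -- below them the lookback copy of V.  Binding the current X and Y thus
  -- leaves V, so the renaming [←V/V] is the identity on indices.
  now : ∀ {s} → s ∈ V → s ∈ Y ++ (X ++ V)
  now x with ∈-++⁻ X x
  ... | inj₁ x∈X = ∈-++⁺ʳ Y (∈-++⁺ˡ x∈X)
  ... | inj₂ y∈Y = ∈-++⁺ˡ y∈Y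

  atOr : ∀ {s} → Variable s → s ∈ Y ++ (X ++ V)
  atOr (current x)  = now x
  atOr (lookback x) = ∈-++⁺ʳ Y (∈-++⁺ʳ X x)

  -- Variables y do not occur in the formulas at AND-node edges.
  atAnd : ∀ {s} → Variable s → s ∈ X ++ V
  atAnd (lookback x) = ∈-++⁺ʳ X x
  atAnd (current x) with ∈-++⁻ X x
  ... | inj₁ x∈X = ∈-++⁺ˡ x∈X
  ... | inj₂ _   = ∈-++⁺ʳ X x

  toFormula : ∀ {Γ} → (∀ {s} → Variable s → s ∈ Γ) → Boolean PAtom → Formula Γ
  toFormula r ttᵇ      = ⊤′
  toFormula r ffᵇ      = ⊥′
  toFormula r (posᵇ a) = atom′ (mapAtom r a)
  toFormula r (negᵇ a) = ¬′ atom′ (mapAtom r a)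
  toFormula r (φ ∧ᵇ χ) = toFormula r φ ∧′ toFormula r χ
  toFormula r (φ ∨ᵇ χ) = toFormula r φ ∨′ toFormula r χ

  module Graph (ψ : Property) where

    -- AND-nodes are identified with their labels, and the OR-node n_i with
    -- sub_i, which determines its outgoing edges.  The graph is the part
    -- reachable from s₀.
    s₀ : Label
    s₀ = mapLTL atom ψ

    andEdges : Label → List (Boolean PAtom × Label)
    andEdges s = if does (final? s) then [] else decomp (xnf s) (C-env ψ)

    orEdges : Label → List (Boolean PAtom × Label)
    orEdges t = map (λ (ς , sub) → ς , xnf (rmX sub)) (decomp (xnf t) (C-ag ψ))

    Pre′ : (Label → Formula V) → Label → Formula (X ++ V)
    Pre′ 𝒞 t =
      ⋁′ (map (λ (ς , s) → ∃[ Y ]′ (toFormula atOr ς ∧′ rename now (𝒞 s))) (orEdges t))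

    Pre : (Label → Formula V) → Label → Formula V
    Pre 𝒞 s = ⋀′ (map (λ (w , t) → ∀[ X ] (toFormula atAnd w ⇒′ Pre′ 𝒞 t)) (andEdges s))

    Win : ℕ → Label → Formula V
    Win zero    s = if does (final? s) then ⊤′ else ⊥′
    Win (suc i) s = Win i s ∨′ Pre (Win i) s

    -- Win(AO_ψ) = ⋁ᵢ Winᵢ(s₀) is defined as Win_K(s₀).  Equivalence of
    -- Win_K(s₀) and Win_{K+1}(s₀) alone is too weak: for next (next tt)
    -- both are ⊥ at K = 0.
    WinStableAt : ℕ → Set₁
    WinStableAt K = ∀ M (ρ : Env M V) i → _⊨_ M ρ (Win i s₀) → _⊨_ M ρ (Win K s₀)

    module _ (M : Structure) (K : ℕ) where
      open Semantics M

      module _ (g : Strategy) (π : ℕ → Env M X) where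
        open Play g π

        -- The k-th answer of g at s is a valid choice leading to u.
        -- (w has no Y-variables, so η_k and play k agree on it.)
        record Move (k : ℕ) (s u : Label) : Set where
          field
            {w ς}  : Boolean PAtom
            {t}    : Label
            s→t    : (w , t) ∈ andEdges s
            w-true : HoldsBoolean (playBefore k) (play k) w
            t→u    : (ς , u) ∈ orEdges t
            ς-true : HoldsBoolean (playBefore k) (play k) ς
            wins   : _⊨_ M (play k) (Win (K ∸ k) u)

        data Reaches : ℕ → Label → Set where
          start : Reaches zero s₀
          step  : ∀ {k s u} → Reaches k s → ¬ Final s → Move k s u → Reaches (suc k) u

      -- g is a strategy obtained by making, at each non-final node, one of
      -- the admissible choices; after a final node it is unconstrained.
      IsG : Strategy → Set
      IsG g = ∀ π {k s} → Reaches g π k s → ¬ Final s → ∃[ u ] Move g π k s u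

    GRealizesIn : Structure → ℕ → Set
    GRealizesIn M K =
      ∃ (IsG M K) × (∀ g → IsG M K g → Semantics.Realizes M g ψ)

  open Graph public

  -- g is played in the models of Win(AO_ψ); these have to include every
  -- model of 𝒯 in which ψ is realizable.
  record Solvable (𝒯 : Theory) (Class : Property → Set) : Set₂ where
    field
      decidable   : Decidable {A = Σ Property Class} (λ (ψ , _) → Realizable 𝒯 ψ)
      win-defined : Classical → ∀ ψ → Class ψ → ∃ (WinStableAt ψ)
      g-defined   : Classical → ∀ ψ → Class ψ → ∀ K → WinStableAt ψ K →
                    ∀ M → ModelOf M 𝒯 → Semantics.RealizableIn M ψ →
                    Satisfies M (Win ψ K (s₀ ψ))
      g-realizes  : Classical → ∀ ψ → Class ψ → ∀ K → WinStableAt ψ K →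
                    ∀ M → ModelOf M 𝒯 → Satisfies M (Win ψ K (s₀ ψ)) →
                    GRealizesIn ψ M K

{-# OPTIONS --safe #-}
module Submission where

-- A round affects the game only through the truth values σ it gives to the
-- atoms of ψ: every u reached from s by a round is propositionally equivalent
-- to one label `progress σ s`.  Pulling valuations back along a trace shows that
-- the trace satisfies ψ iff the label reached at its end is final, and, as ψ is
-- lookback-free, Winᵢ(s) says that the agent can force a final label within i
-- rounds.  Up to equivalence only finitely many labels are reachable from ψ,
-- which bounds the number of rounds needed, independently of the structure.
-- Whether the agent wins depends only on which sets Q of outcomes it can force
-- in one round, and "every Q in 𝒢 can be forced" is a ∀*∃* sentence.

open import Defs
open import Data.Bool.Base using (Bool; true; false; not; _∧_; _∨_; if_then_else_; T)
open import Data.Bool.ListAction using (any; all)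
open import Data.Bool.Properties
  using (∨-identityʳ; ∧-identityʳ; not-injective; T-∧; T-∨; T-≡; T?)
open import Data.Empty using (⊥-elim)
open import Data.Fin.Base as Fin using (Fin; toℕ; fromℕ<; finToFun; funToFin)
open import Data.Fin.Properties
  using (pigeonhole; toℕ<n; toℕ-fromℕ<; finToFun-funToFin; toℕ-injective)
open import Data.List.Base
  using (List; []; _∷_; _++_; map; _∷ʳ_; reverse; length; lookup; applyUpTo; applyDownFrom;
        filter)
open import Data.List.Membership.Propositional using (_∈_; _∉_; find; lose)
open import Data.List.Membership.Propositional.Properties
  using (∈-++⁺ˡ; ∈-++⁺ʳ; ∈-map⁺; ∈-map⁻; ∈-++⁻; ∈-filter⁺; ∈-filter⁻)
open import Data.List.Properties using (reverse-applyUpTo; length-applyDownFrom; applyUpTo-∷ʳ)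
open import Data.List.Relation.Unary.All as All using (All; []; _∷_)
open import Data.List.Relation.Unary.All.Properties using (++⁺; all⁺; all⁻)
open import Data.List.Relation.Unary.AllPairs using (AllPairs; []; _∷_)
open import Data.List.Relation.Unary.Any using (here; there; index)
open import Data.List.Relation.Unary.Any.Properties using (lookup-index; ++⁺∘++⁻; any⁺; any⁻)
open import Data.Maybe.Base using (Maybe; just)
open import Data.Nat.Base
  using (ℕ; zero; suc; _+_; _∸_; _^_; _≤_; _<_; s≤s⁻¹; _≤′_; ≤′-refl; ≤′-step)
open import Data.Nat.Properties
  using (≤⇒≤′; ≤-refl; n<1+n; m≤m+n; +-suc; +-identityʳ; ≤-trans; ≤-reflexive; ≤-antisym;
        <-irrefl; n≤1+n; m≤n⇒m<n∨m≡n; suc-injective; +-comm; ≤-<-trans; n∸n≡0)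
open import Data.Product.Base using (_×_; _,_; proj₁; proj₂; Σ; ∃; Σ-syntax; ∃-syntax)
open import Data.Product.Function.NonDependent.Propositional using (_×-⇔_)
open import Data.Sum.Base using (_⊎_; inj₁; inj₂; [_,_]′)
open import Data.Sum.Function.Propositional using (_⊎-⇔_)
open import Data.Unit.Base using (tt; ⊤)
open import Function.Base using (_∘_)
open import Function.Bundles using (_⇔_; mk⇔; Equivalence)
open import Function.Construct.Composition using (_⇔-∘_)
open import Function.Construct.Identity using (⇔-id)
open import Function.Construct.Symmetry using (⇔-sym)
open import Function.Related.TypeIsomorphisms using (¬-cong-⇔; →-cong-⇔)
open import Relation.Binary.Definitions using (DecidableEquality)
open import Relation.Binary.PropositionalEquality
  using (_≡_; refl; sym; trans; cong; cong₂; module ≡-Reasoning; _≗_; subst; _≢_)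
open import Relation.Nullary using (¬_; Dec; yes; no; does; contradiction; ofʸ; ofⁿ)
open import Relation.Nullary.Decidable using (decidable-stable; dec-true; dec-false; map′)
open import Relation.Nullary.Reflects using (fromEquivalence)
import Level

-- The Win formulas themselves are not handed to the satisfiability procedure: every step of `Win`
-- nests another `∀[ X ]` over `∃[ Y ]′`, so they leave the ∀*∃* fragment. Sets of outcomes avoid
-- the nesting, because without lookback every round offers the same family of forceable sets.
-- Winning is monotone in that family, so it is enough to claim that the goals in 𝒢 can be forced;
-- claiming that other sets cannot be forced would need ∃*∀* sentences.
--
-- The procedure must run without excluded middle, so it cannot compute the forceable sets of a
-- structure. It tries each of the finitely many candidates 𝒢 instead, solving a finite game on
-- labels and testing one sentence. The number of rounds must likewise be read off the syntax.
-- Nothing bounds the labels as terms, so the count is of Boolean functions over a fixed finite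
-- basis.
--
-- Decompositions are arbitrary, so graph labels are never compared as terms with progressed ones:
-- all transport between the two goes through `≡ₚ`, and every notion of winning has to respect it.

-- Propositional evaluation, disjoint case splits and subproperties

module _ {A : Set} where

  value-cong : ∀ {ν ν′ : Valuation A} → (∀ φ → ν φ ≡ ν′ φ) → ∀ φ → value ν φ ≡ value ν′ φ
  value-cong h tt            = refl
  value-cong h ff            = refl
  value-cong h (pos a)       = h (pos a)
  value-cong h (neg a)       = cong not (h (pos a))
  value-cong h (φ and χ)     = cong₂ _∧_ (value-cong h φ) (value-cong h χ)
  value-cong h (φ or χ)      = cong₂ _∨_ (value-cong h φ) (value-cong h χ)
  value-cong h (next φ)      = h (next φ)
  value-cong h (wnext φ)     = h (wnext φ)
  value-cong h (φ until χ)   = h (φ until χ)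
  value-cong h (φ release χ) = h (φ release χ)

  ⋁-true⁻ : ∀ (ν : Valuation A) {B : Set} (f : B → LTL A) xs →
            value ν (⋁ (map f xs)) ≡ true → ∃[ x ] (x ∈ xs × value ν (f x) ≡ true)
  ⋁-true⁻ ν f (x ∷ xs) eq with value ν (f x) in fx
  ... | true  = x , here refl , fx
  ... | false with ⋁-true⁻ ν f xs eq
  ...   | y , y∈xs , fy = y , there y∈xs , fy

  ⋁-apart : ∀ (ν : Valuation A) {B : Set} (f : B → LTL A) {b} (ds : List (B × LTL A)) →
            value ν (f b) ≡ true → All (λ (b′ , _) → (f b and f b′) ≡ₚ ff) ds →
            value ν (⋁ (map (λ (b , sub) → f b and sub) ds)) ≡ false
  ⋁-apart ν f []              b-true []             = refl
  ⋁-apart ν f ((b′ , _) ∷ ds) b-true (apart ∷ rest) with apart ν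
  ... | b′-false rewrite b-true | b′-false = ⋁-apart ν f ds b-true rest

  -- A true guard makes every other guard false, so the case split collapses to its own branch.
  ⋁-disjoint : ∀ (ν : Valuation A) {B : Set} (f : B → LTL A) (ds : List (B × LTL A)) →
               AllPairs (λ (b , _) (b′ , _) → (f b and f b′) ≡ₚ ff) ds →
               ∀ {b sub} → (b , sub) ∈ ds → value ν (f b) ≡ true →
               value ν (⋁ (map (λ (b , sub) → f b and sub) ds)) ≡ value ν sub
  ⋁-disjoint ν f ((b , sub) ∷ ds) (apart ∷ disjoint) (here refl) b-true
    rewrite ⋁-apart ν f ds b-true apart | b-true = ∨-identityʳ _
  ⋁-disjoint ν f ((b′ , _) ∷ ds) (apart ∷ disjoint) (there b∈ds) b-true
    with All.lookup apart b∈ds ν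
  ... | both rewrite b-true | trans (sym (∧-identityʳ _)) both =
    ⋁-disjoint ν f ds disjoint b∈ds b-true

  subproperties proper : LTL A → List (LTL A)
  subproperties φ = φ ∷ proper φ
  proper (φ and χ)     = subproperties φ ++ subproperties χ
  proper (φ or χ)      = subproperties φ ++ subproperties χ
  proper (next φ)      = subproperties φ
  proper (wnext φ)     = subproperties φ
  proper (φ until χ)   = subproperties φ ++ subproperties χ
  proper (φ release χ) = subproperties φ ++ subproperties χ
  proper _             = []

  subproperties-trans : ∀ (φ : LTL A) {χ ξ} →
                        χ ∈ subproperties φ → ξ ∈ subproperties χ → ξ ∈ subproperties φ
  subproperties-trans-++ : ∀ (φ φ′ : LTL A) {χ ξ} →
                           χ ∈ subproperties φ ++ subproperties φ′ → ξ ∈ subproperties χ →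
                           ξ ∈ subproperties φ ++ subproperties φ′
  subproperties-trans φ             (here refl) ξ∈ = ξ∈
  subproperties-trans (φ and χ)     (there χ∈) ξ∈ = there (subproperties-trans-++ φ χ χ∈ ξ∈)
  subproperties-trans (φ or χ)      (there χ∈) ξ∈ = there (subproperties-trans-++ φ χ χ∈ ξ∈)
  subproperties-trans (next φ)      (there χ∈) ξ∈ = there (subproperties-trans φ χ∈ ξ∈)
  subproperties-trans (wnext φ)     (there χ∈) ξ∈ = there (subproperties-trans φ χ∈ ξ∈)
  subproperties-trans (φ until χ)   (there χ∈) ξ∈ = there (subproperties-trans-++ φ χ χ∈ ξ∈)
  subproperties-trans (φ release χ) (there χ∈) ξ∈ = there (subproperties-trans-++ φ χ χ∈ ξ∈)
  subproperties-trans-++ φ φ′ χ∈ ξ∈ with ∈-++⁻ (subproperties φ) χ∈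
  ... | inj₁ χ∈φ  = ∈-++⁺ˡ (subproperties-trans φ χ∈φ ξ∈)
  ... | inj₂ χ∈φ′ = ∈-++⁺ʳ (subproperties φ) (subproperties-trans φ′ χ∈φ′ ξ∈)

-- Progression of labels through one instant

module Progression {A : Set} (_≟_ : DecidableEquality A) where
  open WithLast _≟_
  open import Data.List.Membership.DecPropositional _≟_ using (_∈?_)

  infixl 9 _[_]
  -- A label map that commutes with `and`, `or` and the negation of literals acts as a substitution
  -- for the opaque propositions, so evaluating its image amounts to evaluating the original label
  -- at the pulled-back valuation. `value-xnf` and `value-rmX` are instances; `rmX` respects
  -- negation because it sends `pos last` and `neg last` to complementary constants.
  _[_] : Valuation Proposition → (Label → Label) → Valuation Proposition
  (ν [ f ]) φ = value ν (f φ)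

  value-xnf : ∀ ν φ → value ν (xnf φ) ≡ value (ν [ xnf ]) φ
  value-xnf ν tt            = refl
  value-xnf ν ff            = refl
  value-xnf ν (pos p)       = refl
  value-xnf ν (neg p)       = refl
  value-xnf ν (φ and χ)     = cong₂ _∧_ (value-xnf ν φ) (value-xnf ν χ)
  value-xnf ν (φ or χ)      = cong₂ _∨_ (value-xnf ν φ) (value-xnf ν χ)
  value-xnf ν (next φ)      = refl
  value-xnf ν (wnext φ)     = refl
  value-xnf ν (φ until χ)   = refl
  value-xnf ν (φ release χ) = refl

  value-rmX : ∀ ν φ → value ν (rmX φ) ≡ value (ν [ rmX ]) φ
  value-rmX ν tt             = refl
  value-rmX ν ff             = refl
  value-rmX ν (pos last)     = refl
  value-rmX ν (pos (atom a)) = refl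
  value-rmX ν (neg last)     = refl
  value-rmX ν (neg (atom a)) = refl
  value-rmX ν (φ and χ)      = cong₂ _∧_ (value-rmX ν φ) (value-rmX ν χ)
  value-rmX ν (φ or χ)       = cong₂ _∨_ (value-rmX ν φ) (value-rmX ν χ)
  value-rmX ν (next φ)       = refl
  value-rmX ν (wnext φ)      = refl
  value-rmX ν (φ until χ)    = refl
  value-rmX ν (φ release χ)  = refl

  xnf-idem : ∀ φ → xnf (xnf φ) ≡ xnf φ
  xnf-idem tt            = refl
  xnf-idem ff            = refl
  xnf-idem (pos p)       = refl
  xnf-idem (neg p)       = refl
  xnf-idem (φ and χ)     = cong₂ _and_ (xnf-idem φ) (xnf-idem χ)
  xnf-idem (φ or χ)      = cong₂ _or_ (xnf-idem φ) (xnf-idem χ)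
  xnf-idem (next φ)      = refl
  xnf-idem (wnext φ)     = refl
  xnf-idem (φ until χ)   = cong₂ _or_ (xnf-idem χ) (cong₂ _and_ (xnf-idem φ) refl)
  xnf-idem (φ release χ) =
    cong₂ _and_ (cong₂ _or_ (xnf-idem χ) refl) (cong₂ _or_ (xnf-idem φ) refl)

  xnf-XNF : ∀ φ → XNF (xnf φ)
  xnf-XNF tt            = tt
  xnf-XNF ff            = tt
  xnf-XNF (pos p)       = tt
  xnf-XNF (neg p)       = tt
  xnf-XNF (φ and χ)     = xnf-XNF φ , xnf-XNF χ
  xnf-XNF (φ or χ)      = xnf-XNF φ , xnf-XNF χ
  xnf-XNF (next φ)      = tt
  xnf-XNF (wnext φ)     = tt
  xnf-XNF (φ until χ)   = xnf-XNF χ , xnf-XNF φ , tt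
  xnf-XNF (φ release χ) = (xnf-XNF χ , tt) , xnf-XNF φ , tt

  -- In normal form, `until` and `release` occur only below `next` and `wnext`, so their values are
  -- never consulted.
  value-xnf-cong : ∀ {ν ν′ : Valuation Proposition} →
                   (∀ p → ν (pos p) ≡ ν′ (pos p)) →
                   (∀ φ → ν (next φ) ≡ ν′ (next φ)) → (∀ φ → ν (wnext φ) ≡ ν′ (wnext φ)) →
                   ∀ φ → value ν (xnf φ) ≡ value ν′ (xnf φ)
  value-xnf-cong hp hn hw = go
    where
    go : ∀ φ → value _ (xnf φ) ≡ value _ (xnf φ)
    go tt            = refl
    go ff            = refl
    go (pos p)       = hp p
    go (neg p)       = cong not (hp p)
    go (φ and χ)     = cong₂ _∧_ (go φ) (go χ)
    go (φ or χ)      = cong₂ _∨_ (go φ) (go χ)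
    go (next φ)      = hn φ
    go (wnext φ)     = hw φ
    go (φ until χ)   = cong₂ _∨_ (go χ) (cong₂ _∧_ (go φ) (hn _))
    go (φ release χ) = cong₂ _∧_ (cong₂ _∨_ (go χ) (hp last)) (cong₂ _∨_ (go φ) (hw _))

  override : List A → (A → Bool) → Valuation Proposition → Valuation Proposition
  override C σ ν (pos (atom a)) = if does (a ∈? C) then σ a else ν (pos (atom a))
  override C σ ν φ              = ν φ

  override-∈ : ∀ {C} σ ν {a} → a ∈ C → override C σ ν (pos (atom a)) ≡ σ a
  override-∈ {C} σ ν {a} a∈C with a ∈? C
  ... | yes _  = refl
  ... | no a∉C = contradiction a∈C a∉C

  override-∉ : ∀ {C} σ ν {a} → a ∉ C → override C σ ν (pos (atom a)) ≡ ν (pos (atom a))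
  override-∉ {C} σ ν {a} a∉C with a ∈? C
  ... | yes a∈C = contradiction a∈C a∉C
  ... | no _    = refl

  constant : Bool → Label
  constant true  = tt
  constant false = ff

  -- The syntactic counterpart of `override`: it lets progression yield a label rather than a
  -- valuation.
  assign : List A → (A → Bool) → Label → Label
  assign C σ (pos (atom a)) = if does (a ∈? C) then constant (σ a) else pos (atom a)
  assign C σ (neg (atom a)) = if does (a ∈? C) then constant (not (σ a)) else neg (atom a)
  assign C σ (φ and χ)      = assign C σ φ and assign C σ χ
  assign C σ (φ or χ)       = assign C σ φ or assign C σ χ
  assign C σ φ              = φ

  value-constant : ∀ ν b → value ν (constant b) ≡ b
  value-constant ν true  = refl
  value-constant ν false = refl

  value-assign : ∀ C σ ν φ → value ν (assign C σ φ) ≡ value (override C σ ν) φ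
  value-assign C σ ν (pos (atom a)) with does (a ∈? C)
  ... | true  = value-constant ν (σ a)
  ... | false = refl
  value-assign C σ ν (neg (atom a)) with does (a ∈? C)
  ... | true  = value-constant ν (not (σ a))
  ... | false = refl
  value-assign C σ ν (φ and χ)     = cong₂ _∧_ (value-assign C σ ν φ) (value-assign C σ ν χ)
  value-assign C σ ν (φ or χ)      = cong₂ _∨_ (value-assign C σ ν φ) (value-assign C σ ν χ)
  value-assign C σ ν tt            = refl
  value-assign C σ ν ff            = refl
  value-assign C σ ν (pos last)    = refl
  value-assign C σ ν (neg last)    = refl
  value-assign C σ ν (next φ)      = refl
  value-assign C σ ν (wnext φ)     = refl
  value-assign C σ ν (φ until χ)   = refl
  value-assign C σ ν (φ release χ) = refl

  -- Evaluation consults a valuation only at the atoms of the literals and at the temporally-rooted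
  -- properties in `tnps φ`, and overriding touches only atoms in C.
  value-override-∉ : ∀ {C} φ σ ν →
                     (∀ {a} → a ∈ C → pos (atom a) ∉ tnps φ × neg (atom a) ∉ tnps φ) →
                     value (override C σ ν) φ ≡ value ν φ
  value-override-∉ tt             σ ν h = refl
  value-override-∉ ff             σ ν h = refl
  value-override-∉ (pos (atom a)) σ ν h = override-∉ σ ν (λ a∈C → proj₁ (h a∈C) (here refl))
  value-override-∉ (pos last)     σ ν h = refl
  value-override-∉ (neg (atom a)) σ ν h =
    cong not (override-∉ σ ν (λ a∈C → proj₂ (h a∈C) (here refl)))
  value-override-∉ (neg last)     σ ν h = refl
  value-override-∉ (φ and χ)      σ ν h =
    cong₂ _∧_ (value-override-∉ φ σ ν λ a∈C → proj₁ (h a∈C) ∘ ∈-++⁺ˡ , proj₂ (h a∈C) ∘ ∈-++⁺ˡ)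
              (value-override-∉ χ σ ν λ a∈C → proj₁ (h a∈C) ∘ ∈-++⁺ʳ (tnps φ) ,
                                              proj₂ (h a∈C) ∘ ∈-++⁺ʳ (tnps φ))
  value-override-∉ (φ or χ)       σ ν h =
    cong₂ _∨_ (value-override-∉ φ σ ν λ a∈C → proj₁ (h a∈C) ∘ ∈-++⁺ˡ , proj₂ (h a∈C) ∘ ∈-++⁺ˡ)
              (value-override-∉ χ σ ν λ a∈C → proj₁ (h a∈C) ∘ ∈-++⁺ʳ (tnps φ) ,
                                              proj₂ (h a∈C) ∘ ∈-++⁺ʳ (tnps φ))
  value-override-∉ (next φ)       σ ν h = refl
  value-override-∉ (wnext φ)      σ ν h = refl
  value-override-∉ (φ until χ)    σ ν h = refl
  value-override-∉ (φ release χ)  σ ν h = refl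

  afterwards : Valuation Proposition → Valuation Proposition
  afterwards ν = ν [ xnf ∘ rmX ]

  value-afterwards : ∀ ν φ → value ν (xnf (rmX φ)) ≡ value (afterwards ν) φ
  value-afterwards ν φ = begin
    value ν (xnf (rmX φ))       ≡⟨ value-xnf ν (rmX φ) ⟩
    value (ν [ xnf ]) (rmX φ)   ≡⟨ value-rmX (ν [ xnf ]) φ ⟩
    value (ν [ xnf ] [ rmX ]) φ ≡⟨ value-cong (λ ρ → sym (value-xnf ν (rmX ρ))) φ ⟩
    value (afterwards ν) φ      ∎
    where open ≡-Reasoning

  progress : List A → (A → Bool) → Label → Label
  progress C σ s = xnf (rmX (assign C σ (xnf s)))

  -- xnf and rmX substitute for opaque propositions, so progressing a label
  -- past an instant at which the atoms of C are given by σ amounts to pulling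
  -- valuations back from the next instant.
  pull : List A → (A → Bool) → Valuation Proposition → Valuation Proposition
  pull C σ ν = override C σ (afterwards ν) [ xnf ]

  value-progress : ∀ C σ ν s → value ν (progress C σ s) ≡ value (pull C σ ν) s
  value-progress C σ ν s = begin
    value ν (progress C σ s)                   ≡⟨ value-afterwards ν (assign C σ (xnf s)) ⟩
    value (afterwards ν) (assign C σ (xnf s))  ≡⟨ value-assign C σ (afterwards ν) (xnf s) ⟩
    value (override C σ (afterwards ν)) (xnf s) ≡⟨ value-xnf (override C σ (afterwards ν)) s ⟩
    value (pull C σ ν) s                       ∎
    where open ≡-Reasoning

  progress-cong : ∀ C σ {s s′} → s ≡ₚ s′ → progress C σ s ≡ₚ progress C σ s′
  progress-cong C σ {s} {s′} s≡s′ ν =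
    trans (value-progress C σ ν s) (trans (s≡s′ _) (sym (value-progress C σ ν s′)))

  progress-cong-atoms : ∀ {C σ σ′} s → (∀ {a} → a ∈ C → σ a ≡ σ′ a) →
                        progress C σ s ≡ₚ progress C σ′ s
  progress-cong-atoms {C} {σ} {σ′} s same ν = trans (value-progress C σ ν s)
    (trans (value-cong (λ φ → value-cong override-same (xnf φ)) s) (sym (value-progress C σ′ ν s)))
    where
    override-same : ∀ φ → override C σ (afterwards ν) φ ≡ override C σ′ (afterwards ν) φ
    override-same (pos (atom a)) with a ∈? C
    ... | yes a∈C = same a∈C
    ... | no _    = refl
    override-same (pos last)     = refl
    override-same tt             = refl
    override-same ff             = refl
    override-same (neg p)        = refl
    override-same (φ and χ)      = refl
    override-same (φ or χ)       = refl
    override-same (next φ)       = refl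
    override-same (wnext φ)      = refl
    override-same (φ until χ)    = refl
    override-same (φ release χ)  = refl

  Final-resp : ∀ {s s′} → s ≡ₚ s′ → Final s → Final s′
  Final-resp s≡s′ fin ν ν-last = trans (sym (s≡s′ ν)) (fin ν ν-last)

  -- `pull` already reads every opaque proposition through `xnf`, and `xnf` is idempotent, so
  -- normalizing beforehand changes nothing.
  pull-xnf : ∀ C σ ν φ → value (pull C σ ν) (xnf φ) ≡ value (pull C σ ν) φ
  pull-xnf C σ ν φ = begin
    value (pull C σ ν) (xnf φ) ≡⟨ value-xnf ν′ (xnf φ) ⟨
    value ν′ (xnf (xnf φ))     ≡⟨ cong (value ν′) (xnf-idem φ) ⟩
    value ν′ (xnf φ)           ≡⟨ value-xnf ν′ φ ⟩
    value (pull C σ ν) φ       ∎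
    where
    open ≡-Reasoning
    ν′ = override C σ (afterwards ν)

  -- pull makes `last` false, which turns the clauses of xnf into the usual
  -- expansion laws.
  pull-until : ∀ C σ ν φ χ → pull C σ ν (φ until χ) ≡
               value (pull C σ ν) χ ∨ (value (pull C σ ν) φ ∧ pull C σ ν (next (φ until χ)))
  pull-until C σ ν φ χ =
    cong₂ _∨_ (value-xnf (override C σ (afterwards ν)) χ)
              (cong₂ _∧_ (value-xnf (override C σ (afterwards ν)) φ) refl)

  pull-release : ∀ C σ ν φ χ → pull C σ ν (φ release χ) ≡
                 value (pull C σ ν) χ ∧ (value (pull C σ ν) φ ∨ pull C σ ν (wnext (φ release χ)))
  pull-release C σ ν φ χ =
    cong₂ _∧_ (trans (∨-identityʳ _) (value-xnf (override C σ (afterwards ν)) χ))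
              (cong₂ _∨_ (value-xnf (override C σ (afterwards ν)) φ) refl)

  -- The default `false` is never consulted by `evaluate`, since a `Boolean A` contains only atoms.
  valuation : (A → Bool) → Valuation Proposition
  valuation σ (pos (atom a)) = σ a
  valuation σ φ              = false

  evaluate : (A → Bool) → Boolean A → Bool
  evaluate σ φ = value (valuation σ) (fromBoolean atom φ)

  value-fromBoolean : ∀ C σ ν φ → (∀ {a} → a ∈ atomsᵇ φ → a ∈ C) →
                      value (override C σ ν) (fromBoolean atom φ) ≡ evaluate σ φ
  value-fromBoolean C σ ν ttᵇ      h = refl
  value-fromBoolean C σ ν ffᵇ      h = refl
  value-fromBoolean C σ ν (posᵇ a) h = override-∈ σ ν (h (here refl))
  value-fromBoolean C σ ν (negᵇ a) h = cong not (override-∈ σ ν (h (here refl)))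
  value-fromBoolean C σ ν (φ ∧ᵇ χ) h =
    cong₂ _∧_ (value-fromBoolean C σ ν φ (h ∘ ∈-++⁺ˡ))
              (value-fromBoolean C σ ν χ (h ∘ ∈-++⁺ʳ (atomsᵇ φ)))
  value-fromBoolean C σ ν (φ ∨ᵇ χ) h =
    cong₂ _∨_ (value-fromBoolean C σ ν φ (h ∘ ∈-++⁺ˡ))
              (value-fromBoolean C σ ν χ (h ∘ ∈-++⁺ʳ (atomsᵇ φ)))

  module _ {s C ds} (isDec : IsDecomposition s C ds) where
    open IsDecomposition isDec

    some-edge : ∀ σ → ∃[ prm ] ∃[ sub ] ((prm , sub) ∈ ds × evaluate σ prm ≡ true)
    some-edge σ
      with ⋁-true⁻ (valuation σ) (fromBoolean atom ∘ proj₁) ds (exhaustive (valuation σ))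
    ... | (prm , sub) , ∈ds , eq = prm , sub , ∈ds , eq

    -- The atoms of C are absent from `tnps sub`, so they may be set as σ says; at the resulting
    -- valuation the guard is true, and disjointness leaves only this branch of the decomposition.
    edge-pull : ∀ {prm sub} → (prm , sub) ∈ ds → ∀ σ → evaluate σ prm ≡ true →
                ∀ ν → value ν sub ≡ value (override C σ ν) s
    edge-pull {prm} {sub} ∈ds σ prm-true ν = begin
      value ν sub
        ≡⟨ value-override-∉ sub σ ν (sub-atoms ∈ds) ⟨
      value (override C σ ν) sub
        ≡⟨ ⋁-disjoint (override C σ ν) (fromBoolean atom) ds disjoint ∈ds
             (trans (value-fromBoolean C σ ν prm (prm-atoms ∈ds)) prm-true) ⟨
      value (override C σ ν) (⋁ (map (λ (prm , sub) → fromBoolean atom prm and sub) ds))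
        ≡⟨ equivalent (override C σ ν) ⟨
      value (override C σ ν) s ∎
      where open ≡-Reasoning

  -- The graph fixes the atoms in two stages, first those of C₁ and then those of C₂, and normalizes
  -- again in between; `progress` fixes them all at once. The two pulled-back valuations agree on
  -- literals and on `next` and `wnext`, which is all that `xnf s` consults.
  edges-progress : ∀ {s t u w ς C C₁ C₂ ds₁ ds₂} →
    (∀ {a} → a ∈ C₁ → a ∈ C) → (∀ {a} → a ∈ C₂ → a ∈ C) → (∀ {a} → a ∈ C → a ∈ C₁ ⊎ a ∈ C₂) →
    IsDecomposition (xnf s) C₁ ds₁ → IsDecomposition (xnf t) C₂ ds₂ →
    (w , t) ∈ ds₁ → (ς , u) ∈ ds₂ → ∀ σ → evaluate σ w ≡ true → evaluate σ ς ≡ true →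
    xnf (rmX u) ≡ₚ progress C σ s
  edges-progress {s} {t} {u} {C = C} {C₁} {C₂} C₁⊆ C₂⊆ cover dec₁ dec₂ s→t t→u σ w-true ς-true ν =
    begin
      value ν (xnf (rmX u))                 ≡⟨ value-afterwards ν u ⟩
      value (afterwards ν) u                ≡⟨ edge-pull dec₂ t→u σ ς-true (afterwards ν) ⟩
      value ν₂ (xnf t)                      ≡⟨ value-xnf ν₂ t ⟩
      value (ν₂ [ xnf ]) t                  ≡⟨ edge-pull dec₁ s→t σ w-true (ν₂ [ xnf ]) ⟩
      value (override C₁ σ (ν₂ [ xnf ])) (xnf s)
        ≡⟨ value-xnf-cong same (λ _ → refl) (λ _ → refl) s ⟩
      value (override C σ (afterwards ν)) (xnf s) ≡⟨ value-xnf _ s ⟩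
      value (pull C σ ν) s                  ≡⟨ value-progress C σ ν s ⟨
      value ν (progress C σ s)              ∎
    where
    open ≡-Reasoning
    ν₂ = override C₂ σ (afterwards ν)
    same : ∀ p → override C₁ σ (ν₂ [ xnf ]) (pos p) ≡ override C σ (afterwards ν) (pos p)
    same last = refl
    same (atom a) with a ∈? C₁
    ... | yes a∈C₁ = sym (override-∈ σ (afterwards ν) (C₁⊆ a∈C₁))
    ... | no a∉C₁ with a ∈? C₂
    ...   | yes a∈C₂ = sym (override-∈ σ (afterwards ν) (C₂⊆ a∈C₂))
    ...   | no a∉C₂ = sym (override-∉ σ (afterwards ν) λ a∈C → [ a∉C₁ , a∉C₂ ]′ (cover a∈C))

  -- A valuation influences labels progressed from s only through the labels
  -- in basis s.
  basis : Label → List Label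
  basis s = pos last ∷ s ∷ map xnf (subproperties s)

  Agree : List Label → Valuation Proposition → Valuation Proposition → Set
  Agree B ν ν′ = ∀ {φ} → φ ∈ B → value ν φ ≡ value ν′ φ

  Supported : List Label → Label → Set
  Supported B s = ∀ ν ν′ → Agree B ν ν′ → value ν s ≡ value ν′ s

  module _ (C : List A) (σ : A → Bool) {ν ν′ : Valuation Proposition}
           (same-last : ν (pos last) ≡ ν′ (pos last)) where

    Agree-xnf : Label → Set
    Agree-xnf φ = ∀ {ρ} → ρ ∈ subproperties φ → value ν (xnf ρ) ≡ value ν′ (xnf ρ)

    pull-agree-next : ∀ φ → value ν (xnf φ) ≡ value ν′ (xnf φ) →
                      pull C σ ν (next φ) ≡ pull C σ ν′ (next φ)
    pull-agree-next φ eq = cong₂ _∧_ eq (cong not same-last)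

    pull-agree-wnext : ∀ φ → value ν (xnf φ) ≡ value ν′ (xnf φ) →
                       pull C σ ν (wnext φ) ≡ pull C σ ν′ (wnext φ)
    pull-agree-wnext φ eq = cong₂ _∨_ eq same-last

    pull-agree-atom : ∀ a → ν (pos (atom a)) ≡ ν′ (pos (atom a)) →
                      pull C σ ν (pos (atom a)) ≡ pull C σ ν′ (pos (atom a))
    pull-agree-atom a eq with does (a ∈? C)
    ... | true  = refl
    ... | false = eq

    -- Pulling back turns `next φ` into `xnf φ and neg last`, so only `last` and normal forms of
    -- subproperties are consulted. The expansion laws reduce `until` and `release` to their
    -- arguments at this instant and to their own normal form at the next one.
    pull-agree : ∀ φ → Agree-xnf φ → value (pull C σ ν) φ ≡ value (pull C σ ν′) φ
    pull-agree tt             h = refl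
    pull-agree ff             h = refl
    pull-agree (pos (atom a)) h = pull-agree-atom a (h (here refl))
    pull-agree (pos last)     h = refl
    pull-agree (neg (atom a)) h = cong not (pull-agree-atom a (not-injective (h (here refl))))
    pull-agree (neg last)     h = refl
    pull-agree (φ and χ)      h =
      cong₂ _∧_ (pull-agree φ (h ∘ there ∘ ∈-++⁺ˡ))
                (pull-agree χ (h ∘ there ∘ ∈-++⁺ʳ (subproperties φ)))
    pull-agree (φ or χ)       h =
      cong₂ _∨_ (pull-agree φ (h ∘ there ∘ ∈-++⁺ˡ))
                (pull-agree χ (h ∘ there ∘ ∈-++⁺ʳ (subproperties φ)))
    pull-agree (next φ)       h = pull-agree-next φ (h (there (here refl)))
    pull-agree (wnext φ)      h = pull-agree-wnext φ (h (there (here refl)))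
    pull-agree (φ until χ)    h = trans (pull-until C σ ν φ χ) (trans
      (cong₂ _∨_ (pull-agree χ (h ∘ there ∘ ∈-++⁺ʳ (subproperties φ)))
        (cong₂ _∧_ (pull-agree φ (h ∘ there ∘ ∈-++⁺ˡ))
                   (pull-agree-next (φ until χ) (h (here refl)))))
      (sym (pull-until C σ ν′ φ χ)))
    pull-agree (φ release χ)  h = trans (pull-release C σ ν φ χ) (trans
      (cong₂ _∧_ (pull-agree χ (h ∘ there ∘ ∈-++⁺ʳ (subproperties φ)))
        (cong₂ _∨_ (pull-agree φ (h ∘ there ∘ ∈-++⁺ˡ))
                   (pull-agree-wnext (φ release χ) (h (here refl)))))
      (sym (pull-release C σ ν′ φ χ)))

  -- The basis contains the normal form of every subproperty, hence is closed under what a pullback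
  -- consults. This invariant makes every label progressed from s a Boolean function of the same
  -- finitely many bits.
  pull-Agree : ∀ C σ s {ν ν′} → Agree (basis s) ν ν′ →
               Agree (basis s) (pull C σ ν) (pull C σ ν′)
  pull-Agree C σ s {ν} {ν′} agree = go
    where
    agree-xnf : ∀ {χ} → χ ∈ subproperties s → value ν (xnf χ) ≡ value ν′ (xnf χ)
    agree-xnf χ∈ = agree (there (there (∈-map⁺ xnf χ∈)))
    agree-sub : ∀ {χ} → χ ∈ subproperties s → value (pull C σ ν) χ ≡ value (pull C σ ν′) χ
    agree-sub {χ} χ∈ = pull-agree C σ (agree (here refl)) χ (agree-xnf ∘ subproperties-trans s χ∈)
    go : Agree (basis s) (pull C σ ν) (pull C σ ν′)
    go (here refl)         = refl
    go (there (here refl)) = agree-sub (here refl)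
    go (there (there ∈B)) with ∈-map⁻ xnf ∈B
    ... | χ , χ∈ , refl =
      trans (pull-xnf C σ ν χ) (trans (agree-sub χ∈) (sym (pull-xnf C σ ν′ χ)))

  Supported-progress : ∀ C σ s {u} → Supported (basis s) u → Supported (basis s) (progress C σ u)
  Supported-progress C σ s {u} supported ν ν′ agree =
    trans (value-progress C σ ν u)
      (trans (supported _ _ (pull-Agree C σ s agree)) (sym (value-progress C σ ν′ u)))

-- Stabilization of the winning positions

module Stabilization
  (em : {P : Set} → Dec P) {A : Set} {n : ℕ} (code : A → Fin n) (W : ℕ → A → Set)
  (W-suc : ∀ {i a} → W i a → W (suc i) a)
  (W-resp : ∀ {i a b} → code a ≡ code b → W i a → W i b)
  (W-step : ∀ {i} → (∀ a → W (suc i) a → W i a) → ∀ a → W (suc (suc i)) a → W (suc i) a)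
  where

  W-mono : ∀ {i j a} → i ≤ j → W i a → W j a
  W-mono i≤j = go (≤⇒≤′ i≤j)
    where
    go : ∀ {i j a} → i ≤′ j → W i a → W j a
    go ≤′-refl       = λ w → w
    go (≤′-step i≤j) = W-suc ∘ go i≤j

  Stalled : ℕ → Set
  Stalled i = ∀ a → W (suc i) a → W i a

  stalled-later : ∀ {i} → Stalled i → ∀ k → Stalled (k + i)
  stalled-later stalled zero    = stalled
  stalled-later stalled (suc k) = W-step (stalled-later stalled k)

  stalled-forever : ∀ {i} → Stalled i → ∀ k {a} → W (k + i) a → W i a
  stalled-forever stalled zero    w = w
  stalled-forever stalled (suc k) w = stalled-forever stalled k (stalled-later stalled k _ w)

  -- If every stage up to n added something new, two of the n + 1 additions
  -- would have the same code, but the second one would be no news.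
  stable : ∀ {j a} → W j a → W n a
  stable {j} w with em {∃[ i ] (i ≤ n × Stalled i)}
  ... | yes (i , i≤n , stalled) =
    W-mono i≤n (stalled-forever stalled j (W-mono (m≤m+n j i) w))
  ... | no never = contradiction (pigeonhole (n<1+n n) (code ∘ newcomer)) no-collision
    where
    fresh : ∀ (i : Fin (suc n)) → ∃[ a ] (W (suc (toℕ i)) a × ¬ W (toℕ i) a)
    fresh i = decidable-stable em λ none → never
      (toℕ i , s≤s⁻¹ (toℕ<n i) , λ a w → decidable-stable em (λ ¬w → none (a , w , ¬w)))
    newcomer : Fin (suc n) → A
    newcomer = proj₁ ∘ fresh
    no-collision : ¬ (∃[ i ] ∃[ j ] (i Fin.< j × code (newcomer i) ≡ code (newcomer j)))
    no-collision (i , j , i<j , eq) =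
      proj₂ (proj₂ (fresh j)) (W-mono i<j (W-resp eq (proj₁ (proj₂ (fresh i)))))

-- Finite codes of labels and the abstract game

bit : Bool → Fin 2
bit true  = Fin.zero
bit false = Fin.suc Fin.zero

bit-injective : ∀ {b c} → bit b ≡ bit c → b ≡ c
bit-injective {true}  {true}  eq = refl
bit-injective {false} {false} eq = refl

funToFin-injective : ∀ {m n} {f g : Fin m → Fin n} → funToFin f ≡ funToFin g → f ≗ g
funToFin-injective {f = f} {g} eq i =
  trans (sym (finToFun-funToFin f i)) (trans (cong (λ k → finToFun k i) eq) (finToFun-funToFin g i))

module Game {A : Set} (_≟_ : DecidableEquality A) where
  open WithLast _≟_
  open Progression _≟_

  -- The number of Boolean functions of `length (basis s)` bits. Up to `≡ₚ`, all labels progressed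
  -- from s are among them.
  bound : Label → ℕ
  bound s = 2 ^ (2 ^ length (basis s))

  module Coding (em : {P : Set} → Dec P) (B : List Label) where

    vector : Valuation Proposition → Fin (length B) → Fin 2
    vector ν i = bit (value ν (lookup B i))

    vector-Agree : ∀ {ν ν′} → vector ν ≗ vector ν′ → Agree B ν ν′
    vector-Agree {ν} {ν′} eq {φ} φ∈B =
      subst (λ χ → value ν χ ≡ value ν′ χ) (sym (lookup-index φ∈B)) (bit-injective (eq (index φ∈B)))

    -- One row of the truth table of s over B. The entries of B need not be independent, so some
    -- rows come from no valuation; these count as false.
    Achieved : Label → Fin (2 ^ length B) → Set
    Achieved s c = ∃[ ν ] (funToFin (vector ν) ≡ c × value ν s ≡ true)

    code : Label → Fin (2 ^ (2 ^ length B))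
    code s = funToFin λ c → bit (does (em {Achieved s c}))

    achieved-value : ∀ {s} → Supported B s → ∀ ν →
                     does (em {Achieved s (funToFin (vector ν))}) ≡ value ν s
    achieved-value {s} supp ν with em {Achieved s (funToFin (vector ν))}
    ... | yes (ν′ , eq , holds) =
      trans (sym holds) (supp _ _ (vector-Agree (funToFin-injective eq)))
    ... | no none with value ν s in eq
    ...   | true  = contradiction (ν , refl , eq) none
    ...   | false = refl

    code-resp : ∀ {s s′} → Supported B s → Supported B s′ → code s ≡ code s′ → s ≡ₚ s′
    code-resp {s} {s′} supp supp′ eq ν = begin
      value ν s                   ≡⟨ achieved-value {s} supp ν ⟨
      does (em {Achieved s c})    ≡⟨ bit-injective (funToFin-injective eq c) ⟩
      does (em {Achieved s′ c})   ≡⟨ achieved-value {s′} supp′ ν ⟩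
      value ν s′                  ∎
      where
      open ≡-Reasoning
      c = funToFin (vector ν)

  -- In each round the environment picks an element of P and the agent
  -- answers with one of Q, which together determine the truth values of the
  -- atoms in C.
  module _ {P Q : Set} (C : List A) (σ : P → Q → A → Bool) where

    after : P → Q → Label → Label
    after β γ = progress C (σ β γ)

    Wins : ℕ → Label → Set
    Wins zero    s = Final s
    Wins (suc i) s = Wins i s ⊎ (∀ β → ∃[ γ ] Wins i (after β γ s))

    Wins-resp : ∀ i {s s′} → s ≡ₚ s′ → Wins i s → Wins i s′
    Wins-resp zero    {s} {s′} s≡s′ fin = Final-resp {s} {s′} s≡s′ fin
    Wins-resp (suc i) s≡s′ (inj₁ w) = inj₁ (Wins-resp i s≡s′ w)
    Wins-resp (suc i) {s} {s′} s≡s′ (inj₂ w) = inj₂ λ β →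
      let γ , w′ = w β in γ , Wins-resp i (progress-cong C (σ β γ) {s} {s′} s≡s′) w′

    -- Stripping the `inj₁` layers ends at a round that is actually played, as finality is excluded;
    -- the layers are then put back around its result.
    Wins-step : ∀ i {s} → Wins (suc i) s → ¬ Final s → ∀ β → ∃[ γ ] Wins i (after β γ s)
    Wins-step i       (inj₂ w) nonfinal β = w β
    Wins-step zero    (inj₁ w) nonfinal   = contradiction w nonfinal
    Wins-step (suc i) (inj₁ w) nonfinal β =
      let γ , w′ = Wins-step i w nonfinal β in γ , inj₁ w′

    Final⇒Wins : ∀ i {s} → Final s → Wins i s
    Final⇒Wins zero    fin = fin
    Final⇒Wins (suc i) fin = inj₁ (Final⇒Wins i fin)

    labelAt : Label → (List P → Q) → (ℕ → P) → ℕ → Label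
    labelAt s h π zero    = s
    labelAt s h π (suc k) = after (π k) (h (applyUpTo π (suc k))) (labelAt s h π k)

    module _ (em : {P : Set} → Dec P) (s₀ : Label) where

      private
        B = basis s₀
        -- Codes separate labels only if these are supported by B, so stabilization is run on
        -- supported labels alone.
        Position = Σ Label (Supported B)

        next-position : P → Q → Position → Position
        next-position β γ (s , supp) =
          after β γ s , Supported-progress C (σ β γ) s₀ {s} supp

      open Coding em B

      WinsAt : ℕ → Position → Set
      WinsAt i = Wins i ∘ proj₁

      codeAt : Position → Fin (bound s₀)
      codeAt = code ∘ proj₁

      WinsAt-resp : ∀ {i a b} → codeAt a ≡ codeAt b → WinsAt i a → WinsAt i b
      WinsAt-resp {i} {a} {b} eq =
        Wins-resp i (code-resp {proj₁ a} {proj₁ b} (proj₂ a) (proj₂ b) eq)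

      WinsAt-step : ∀ {i} → (∀ a → WinsAt (suc i) a → WinsAt i a) →
                    ∀ a → WinsAt (suc (suc i)) a → WinsAt (suc i) a
      WinsAt-step stalled a (inj₁ w) = w
      WinsAt-step stalled a (inj₂ w) = inj₂ λ β →
        let γ , w′ = w β in γ , stalled (next-position β γ a) w′

      open Stabilization em codeAt WinsAt inj₁
        (λ {i} {a} {b} → WinsAt-resp {i} {a} {b}) WinsAt-step
        using (stable)

      Wins-stable : ∀ {i s} → Supported B s → Wins i s → Wins (bound s₀) s
      Wins-stable {s = s} supp = stable {a = s , supp}

      s₀-supported : Supported B s₀
      s₀-supported _ _ agree = agree (there (here refl))

      -- Where the agent does not win within `bound s₀` rounds, it does not win
      -- within one more, so some choice of the environment leads to a label of
      -- the same kind whatever the answer.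
      evade : P → ∀ h → ¬ Wins (bound s₀) s₀ → ∃[ π ] (∀ k → ¬ Final (labelAt s₀ h π k))
      evade β₀ h lost = π , λ k fin → proj₂ (lost-at k) (Final⇒Wins (bound s₀) fin)
        where
        N = bound s₀
        Trap : Label → P → Set
        Trap s β = ∀ γ → ¬ Wins N (after β γ s)
        trap : ∀ {s} → Supported B s → ¬ Wins N s → ∃ (Trap s)
        trap {s} supp lost = decidable-stable em λ no-trap → lost
          (Wins-stable {suc N} {s} supp (inj₂ λ β →
            decidable-stable em λ none → no-trap (β , λ γ w → none (γ , w))))
        -- The default β₀ is for labels without a trap; `lost-at` shows that the play built from
        -- these choices never meets one.
        pick : Label → P
        pick s with em {∃ (Trap s)}
        ... | yes (β , _) = β
        ... | no _        = β₀
        pick-trap : ∀ {s} → Supported B s → ¬ Wins N s → Trap s (pick s)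
        pick-trap {s} supp lost with em {∃ (Trap s)}
        ... | yes (_ , t) = t
        ... | no none     = contradiction (trap supp lost) none
        -- History and label are built together: h reads the history, while the next choice depends
        -- on the label. Only afterwards is there a π to which `labelAt` can be applied.
        build : ℕ → List P × Label
        build zero    = [] , s₀
        build (suc k) =
          let βs , s = build k
              βs′    = βs ∷ʳ pick s
          in βs′ , after (pick s) (h βs′) s
        π : ℕ → P
        π k = pick (proj₂ (build k))
        build-π : ∀ k → build k ≡ (applyUpTo π k , labelAt s₀ h π k)
        build-π zero    = refl
        build-π (suc k) = cong₂ _,_ moves
          (cong₂ (λ βs s → after (π k) (h βs) s) moves (cong proj₂ (build-π k)))
          where
          moves : proj₁ (build k) ∷ʳ π k ≡ applyUpTo π (suc k)
          moves = trans (cong (_∷ʳ π k) (cong proj₁ (build-π k))) (applyUpTo-∷ʳ π k)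
        lost-at : ∀ k → Supported B (labelAt s₀ h π k) × ¬ Wins N (labelAt s₀ h π k)
        lost-at zero    = s₀-supported , lost
        lost-at (suc k) with lost-at k
        ... | supp , lost-k =
          Supported-progress C (σ (π k) γ) s₀ {labelAt s₀ h π k} supp ,
          subst (λ s → Trap (labelAt s₀ h π k) (pick s)) (sym (cong proj₂ (build-π k)))
                (pick-trap supp lost-k) γ
          where γ = h (applyUpTo π (suc k))

      module Optimal (γ₀ : Q) (K : ℕ) where

        -- The witness is fixed as a function of round, label and environment choice, which makes
        -- the label reached a function of the history. Where no answer wins, `γ₀` fills in.
        choose : ℕ → Label → P → Q
        choose k s β with em {∃[ γ ] Wins (K ∸ k) (after β γ s)}
        ... | yes (γ , _) = γ
        ... | no _        = γ₀

        -- The history is given latest choice first.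
        reached : List P → Label
        reached []       = s₀
        reached (β ∷ βs) = after β (choose (length βs) (reached βs) β) (reached βs)

        answer : List P → Q
        answer []       = γ₀
        answer (β ∷ βs) = choose (length βs) (reached βs) β

        optimal : List P → Q
        optimal = answer ∘ reverse

        reached-labelAt : ∀ π k → reached (applyDownFrom π k) ≡ labelAt s₀ optimal π k
        reached-labelAt π zero    = refl
        reached-labelAt π (suc k) =
          cong₂ (after (π k)) (cong answer (sym (reverse-applyUpTo π (suc k))))
                (reached-labelAt π k)

        optimal-choice : ∀ π k → optimal (applyUpTo π (suc k)) ≡
                         choose k (labelAt s₀ optimal π k) (π k)
        optimal-choice π k = trans (cong answer (reverse-applyUpTo π (suc k)))
          (cong₂ (λ n s → choose n s (π k)) (length-applyDownFrom π k) (reached-labelAt π k))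

        optimal-wins : ∀ π k → (∃[ γ ] Wins (K ∸ k) (after (π k) γ (labelAt s₀ optimal π k))) →
                       Wins (K ∸ k) (labelAt s₀ optimal π (suc k))
        optimal-wins π k (γ , w) rewrite optimal-choice π k
          with em {∃[ γ ] Wins (K ∸ k) (after (π k) γ (labelAt s₀ optimal π k))}
        ... | yes (_ , w′) = w′
        ... | no none      = contradiction (γ , w) none

open Equivalence using (to; from)

-- Satisfaction by traces

T-not : ∀ {b} → T (not b) ⇔ (¬ T b)
T-not {true}  = mk⇔ (λ ()) (λ ¬t → ¬t tt)
T-not {false} = mk⇔ (λ _ ()) (λ _ → tt)

T-does : ∀ {P : Set} (d : Dec P) → T (does d) ⇔ P
T-does (yes p) = mk⇔ (λ _ → p) (λ _ → tt)
T-does (no ¬p) = mk⇔ (λ ()) ¬p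

≡⇒⇔ : ∀ {P Q : Set} → P ≡ Q → P ⇔ Q
≡⇒⇔ refl = ⇔-id _

module Unrolling {A : Set} (_≟_ : DecidableEquality A) (C : List A) (ρ : ℕ → A → Bool) where
  open WithLast _≟_
  open Progression _≟_

  -- Pulls ν back from instant k + r to instant k.
  unroll : ℕ → ℕ → Valuation Proposition → Valuation Proposition
  unroll k zero    ν = ν
  unroll k (suc r) ν = pull C (ρ k) (unroll (suc k) r ν)

  -- `unroll` peels off the first instant, whereas progression appends one at the end; this
  -- exchanges the two recursions.
  unroll-last : ∀ k r ν → unroll k (suc r) ν ≡ unroll k r (pull C (ρ (k + r)) ν)
  unroll-last k zero    ν = cong (λ n → pull C (ρ n) ν) (sym (+-identityʳ k))
  unroll-last k (suc r) ν = cong (pull C (ρ k)) (trans (unroll-last (suc k) r ν)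
    (cong (λ n → unroll (suc k) r (pull C (ρ n) ν)) (sym (+-suc k r))))

  value-unroll : (s : ℕ → Label) → (∀ k → s (suc k) ≡ progress C (ρ k) (s k)) →
                 ∀ n ν → value ν (s n) ≡ value (unroll 0 n ν) (s 0)
  value-unroll s s-suc zero    ν = refl
  value-unroll s s-suc (suc n) ν = begin
    value ν (s (suc n))                       ≡⟨ cong (value ν) (s-suc n) ⟩
    value ν (progress C (ρ n) (s n))          ≡⟨ value-progress C (ρ n) ν (s n) ⟩
    value (pull C (ρ n) ν) (s n)              ≡⟨ value-unroll s s-suc n (pull C (ρ n) ν) ⟩
    value (unroll 0 n (pull C (ρ n) ν)) (s 0) ≡⟨ cong (λ ν → value ν (s 0)) (unroll-last 0 n ν) ⟨
    value (unroll 0 (suc n) ν) (s 0)          ∎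
    where open ≡-Reasoning

module Traces (S : Signature) (X Y : List (Signature.Sort S))
              (M : Properties.Structure S X Y) where
  open Properties S X Y
  open Semantics M

  module _ {n} (τ : Trace n) where

    successor : ∀ (i : Fin n) → suc (toℕ i) ≡ n ⊎ ∃[ j ] (toℕ j ≡ suc (toℕ i))
    successor i with m≤n⇒m<n∨m≡n (toℕ<n i)
    ... | inj₁ i+1<n = inj₂ (fromℕ< i+1<n , toℕ-fromℕ< i+1<n)
    ... | inj₂ i+1≡n = inj₁ i+1≡n

    Holds-until : ∀ i φ χ → Holds τ i (φ until χ) ⇔
                  (Holds τ i χ ⊎ (Holds τ i φ × Holds τ i (next (φ until χ))))
    Holds-until i φ χ = mk⇔ expand contract
      where
      expand : Holds τ i (φ until χ) → Holds τ i χ ⊎ (Holds τ i φ × Holds τ i (next (φ until χ)))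
      expand (j , i≤j , χj , φ<j) with m≤n⇒m<n∨m≡n i≤j
      ... | inj₂ i≡j = inj₁ (subst (λ i → Holds τ i χ) (sym (toℕ-injective i≡j)) χj)
      ... | inj₁ i<j with successor i
      ...   | inj₁ i+1≡n      =
              contradiction (≤-trans (toℕ<n j) (≤-trans (≤-reflexive (sym i+1≡n)) i<j))
                            (<-irrefl refl)
      ...   | inj₂ (i′ , i′≡) = inj₂ (φ<j i ≤-refl i<j ,
              i′ , i′≡ , j , subst (_≤ toℕ j) (sym i′≡) i<j , χj ,
              λ k i′≤k → φ<j k (≤-trans (n≤1+n _) (subst (_≤ toℕ k) i′≡ i′≤k)))
      contract : Holds τ i χ ⊎ (Holds τ i φ × Holds τ i (next (φ until χ))) → Holds τ i (φ until χ)
      contract (inj₁ χi) =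
        i , ≤-refl , χi , λ k i≤k k<i → contradiction (≤-<-trans i≤k k<i) (<-irrefl refl)
      contract (inj₂ (φi , i′ , i′≡ , j , i′≤j , χj , φ<j)) =
        j , ≤-trans (n≤1+n _) i<j , χj , φs
        where
        i<j = subst (_≤ toℕ j) i′≡ i′≤j
        φs : ∀ k → i Fin.≤ k → k Fin.< j → Holds τ k φ
        φs k i≤k k<j with m≤n⇒m<n∨m≡n i≤k
        ... | inj₁ i<k = φ<j k (subst (_≤ toℕ k) (sym i′≡) i<k) k<j
        ... | inj₂ i≡k = subst (λ i → Holds τ i φ) (toℕ-injective i≡k) φi

    Holds-release : ∀ i φ χ → Holds τ i (φ release χ) ⇔
                    (Holds τ i χ × (Holds τ i φ ⊎ Holds τ i (wnext (φ release χ))))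
    Holds-release i φ χ = mk⇔ expand contract
      where
      later : ∀ {i′ : Fin n} → toℕ i′ ≡ suc (toℕ i) → ∀ {k} → i′ Fin.≤ k → i Fin.≤ k
      later i′≡ i′≤k = ≤-trans (n≤1+n _) (subst (_≤ _) i′≡ i′≤k)
      -- `R` is the upper limit on the instants concerned: trivial when χ holds throughout, and at
      -- most j when φ releases it at j.
      extend : ∀ {i′ : Fin n} → toℕ i′ ≡ suc (toℕ i) → Holds τ i χ →
               ∀ {R : Fin n → Set} → (∀ k → i′ Fin.≤ k → R k → Holds τ k χ) →
               ∀ k → i Fin.≤ k → R k → Holds τ k χ
      extend i′≡ χi rest k i≤k with m≤n⇒m<n∨m≡n i≤k
      ... | inj₁ i<k = rest k (subst (_≤ toℕ k) (sym i′≡) i<k)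
      ... | inj₂ i≡k = λ _ → subst (λ i → Holds τ i χ) (toℕ-injective i≡k) χi
      expand : Holds τ i (φ release χ) →
               Holds τ i χ × (Holds τ i φ ⊎ Holds τ i (wnext (φ release χ)))
      expand (inj₁ χ≥) = χ≥ i ≤-refl , inj₂ rest
        where
        rest : Holds τ i (wnext (φ release χ))
        rest with successor i
        ... | inj₁ i+1≡n      = inj₁ i+1≡n
        ... | inj₂ (i′ , i′≡) = inj₂ (i′ , i′≡ , inj₁ λ k i′≤k → χ≥ k (later i′≡ i′≤k))
      expand (inj₂ (j , i≤j , φj , χ≤j)) = χ≤j i ≤-refl i≤j , rest
        where
        rest : Holds τ i φ ⊎ Holds τ i (wnext (φ release χ))
        rest with m≤n⇒m<n∨m≡n i≤j
        ... | inj₂ i≡j = inj₁ (subst (λ i → Holds τ i φ) (sym (toℕ-injective i≡j)) φj)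
        ... | inj₁ i<j with successor i
        ...   | inj₁ i+1≡n      = inj₂ (inj₁ i+1≡n)
        ...   | inj₂ (i′ , i′≡) = inj₂ (inj₂ (i′ , i′≡ , inj₂
                (j , subst (_≤ toℕ j) (sym i′≡) i<j , φj , λ k i′≤k → χ≤j k (later i′≡ i′≤k))))
      contract : Holds τ i χ × (Holds τ i φ ⊎ Holds τ i (wnext (φ release χ))) →
                 Holds τ i (φ release χ)
      contract (χi , inj₁ φi) = inj₂ (i , ≤-refl , φi , λ k i≤k k≤i →
        subst (λ i → Holds τ i χ) (toℕ-injective (≤-antisym i≤k k≤i)) χi)
      contract (χi , inj₂ (inj₁ i+1≡n)) = inj₁ λ k i≤k →
        subst (λ i → Holds τ i χ) (toℕ-injective (≤-antisym i≤k
          (s≤s⁻¹ (subst (suc (toℕ k) ≤_) (sym i+1≡n) (toℕ<n k))))) χi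
      contract (χi , inj₂ (inj₂ (i′ , i′≡ , inj₁ χ≥))) =
        inj₁ λ k i≤k → extend i′≡ χi {λ _ → ⊤} (λ k i′≤k _ → χ≥ k i′≤k) k i≤k tt
      contract (χi , inj₂ (inj₂ (i′ , i′≡ , inj₂ (j , i′≤j , φj , χ≤j)))) =
        inj₂ (j , later i′≡ i′≤j , φj , extend i′≡ χi χ≤j)

    open Progression patom-dec

    module _ (C : List PAtom) (ρ : ℕ → PAtom → Bool)
             (ρ-correct : ∀ (i : Fin n) {a} → a ∈ C →
                          HoldsNow (beforeT τ i) (τ i) a ⇔ T (ρ (toℕ i) a))
             {ν : Valuation Proposition} (ν-last : ν (pos last) ≡ true) where
      open Unrolling patom-dec C ρ

      -- At the end of the trace ν says that the instant just completed was the last one; every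
      -- pullback made before that sets `last` to false.
      instant-last : ∀ r (i : Fin n) → toℕ i + suc r ≡ n →
                     T (unroll (suc (toℕ i)) r ν (pos last)) ⇔ suc (toℕ i) ≡ n
      instant-last zero    i i+1≡n =
        mk⇔ (λ _ → trans (+-comm 1 (toℕ i)) i+1≡n) (λ _ → subst T (sym ν-last) tt)
      instant-last (suc r) i i+r+2≡n = mk⇔ (λ ()) λ i+1≡n →
        contradiction (trans i+r+2≡n (sym i+1≡n)) (m+2+n≢1+m (toℕ i) r)
        where
        m+2+n≢1+m : ∀ m n → ¬ (m + suc (suc n) ≡ suc m)
        m+2+n≢1+m zero    n ()
        m+2+n≢1+m (suc m) n eq = m+2+n≢1+m m n (suc-injective eq)

      -- `r` counts the instants after i. The outer induction, on r, serves what is said about the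
      -- next instant; the inner one, on φ, serves this instant. By the expansion laws `until` and
      -- `release` split into their arguments now and their own `next` or `wnext`, which falls to
      -- the outer induction.
      Holds⇔value : ∀ r i → toℕ i + suc r ≡ n → ∀ φ → (∀ {a} → a ∈ atoms φ → a ∈ C) →
                    Holds τ i φ ⇔ T (value (unroll (toℕ i) (suc r) ν) (mapLTL atom φ))
      Holds⇔value r i i+r+1≡n = go
        where
        k   = toℕ i
        ν⁺  = unroll (suc k) r ν
        ν⁰  = unroll k (suc r) ν

        Matches : Property → Set
        Matches φ = Holds τ i φ ⇔ T (value ν⁰ (mapLTL atom φ))

        at-successor : ∀ φ → (∀ {a} → a ∈ atoms φ → a ∈ C) → ∀ j → toℕ j ≡ suc k →
                       Holds τ j φ ⇔ T (value ν⁺ (xnf (mapLTL atom φ)))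
        at-successor φ ⊆C j j≡ = successor-at r i+r+1≡n
          where
          -- With r zero there is no next instant. Otherwise the valuation is itself a pullback, so
          -- `pull-xnf` absorbs the `xnf` that follows `rmX`.
          successor-at : ∀ r → k + suc r ≡ n →
                         Holds τ j φ ⇔ T (value (unroll (suc k) r ν) (xnf (mapLTL atom φ)))
          successor-at zero    i+1≡n = contradiction
            (subst (_< n) (trans j≡ (trans (+-comm 1 k) i+1≡n)) (toℕ<n j)) (<-irrefl refl)
          successor-at (suc r) i+r+2≡n =
            ≡⇒⇔ (cong T (trans
              (cong (λ k → value (unroll k (suc r) ν) (mapLTL atom φ)) j≡)
              (sym (pull-xnf C (ρ (suc k)) (unroll (suc (suc k)) r ν) (mapLTL atom φ)))))
            ⇔-∘ Holds⇔value r j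
                  (trans (cong (_+ suc r) j≡) (trans (sym (+-suc k (suc r))) i+r+2≡n)) φ ⊆C

        Holds-next : ∀ φ → (∀ {a} → a ∈ atoms φ → a ∈ C) → Matches (next φ)
        Holds-next φ ⊆C = mk⇔
          (λ (j , j≡ , φj) → from T-∧ (to (at-successor φ ⊆C j j≡) φj , from T-not (λ last →
            <-irrefl (trans j≡ (to (instant-last r i i+r+1≡n) last)) (toℕ<n j))))
          λ t → more (proj₁ (to T-∧ t))
                     (to T-not (proj₂ (to (T-∧ {value ν⁺ (xnf (mapLTL atom φ))}) t)))
          where
          more : T (value ν⁺ (xnf (mapLTL atom φ))) → ¬ T (ν⁺ (pos last)) → Holds τ i (next φ)
          more v ¬last with successor i
          ... | inj₁ i+1≡n    = contradiction (from (instant-last r i i+r+1≡n) i+1≡n) ¬last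
          ... | inj₂ (j , j≡) = j , j≡ , from (at-successor φ ⊆C j j≡) v

        Holds-wnext : ∀ φ → (∀ {a} → a ∈ atoms φ → a ∈ C) → Matches (wnext φ)
        Holds-wnext φ ⊆C = mk⇔
          (λ { (inj₁ i+1≡n) → from T-∨ (inj₂ (from (instant-last r i i+r+1≡n) i+1≡n))
             ; (inj₂ (j , j≡ , φj)) → from T-∨ (inj₁ (to (at-successor φ ⊆C j j≡) φj)) })
          λ t → [ more , inj₁ ∘ to (instant-last r i i+r+1≡n) ]′ (to T-∨ t)
          where
          more : T (value ν⁺ (xnf (mapLTL atom φ))) → Holds τ i (wnext φ)
          more v with successor i
          ... | inj₁ i+1≡n    = inj₁ i+1≡n
          ... | inj₂ (j , j≡) = inj₂ (j , j≡ , from (at-successor φ ⊆C j j≡) v)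

        go : ∀ φ → (∀ {a} → a ∈ atoms φ → a ∈ C) → Matches φ
        go tt      ⊆C = ⇔-id _
        go ff      ⊆C = ⇔-id _
        go (pos a) ⊆C = ≡⇒⇔ (cong T (sym (override-∈ (ρ k) (afterwards ν⁺) (⊆C (here refl)))))
                        ⇔-∘ ρ-correct i (⊆C (here refl))
        go (neg a) ⊆C = ⇔-sym T-not ⇔-∘ ¬-cong-⇔ (go (pos a) ⊆C)
        go (φ and χ) ⊆C =
          ⇔-sym T-∧ ⇔-∘ (go φ (⊆C ∘ ∈-++⁺ˡ) ×-⇔ go χ (⊆C ∘ ∈-++⁺ʳ (atoms φ)))
        go (φ or χ) ⊆C =
          ⇔-sym T-∨ ⇔-∘ (go φ (⊆C ∘ ∈-++⁺ˡ) ⊎-⇔ go χ (⊆C ∘ ∈-++⁺ʳ (atoms φ)))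
        go (next φ)  ⊆C = Holds-next φ ⊆C
        go (wnext φ) ⊆C = Holds-wnext φ ⊆C
        go (φ until χ) ⊆C =
          ≡⇒⇔ (cong T (sym (pull-until C (ρ k) ν⁺ (mapLTL atom φ) (mapLTL atom χ))))
          ⇔-∘ (⇔-sym T-∨
          ⇔-∘ ((go χ (⊆C ∘ ∈-++⁺ʳ (atoms φ)) ⊎-⇔
                (⇔-sym T-∧ ⇔-∘ (go φ (⊆C ∘ ∈-++⁺ˡ) ×-⇔ Holds-next (φ until χ) ⊆C)))
          ⇔-∘ Holds-until i φ χ))
        go (φ release χ) ⊆C =
          ≡⇒⇔ (cong T (sym (pull-release C (ρ k) ν⁺ (mapLTL atom φ) (mapLTL atom χ))))
          ⇔-∘ (⇔-sym T-∧
          ⇔-∘ ((go χ (⊆C ∘ ∈-++⁺ʳ (atoms φ)) ×-⇔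
                (⇔-sym T-∨ ⇔-∘ (go φ (⊆C ∘ ∈-++⁺ˡ) ⊎-⇔ Holds-wnext (φ release χ) ⊆C)))
          ⇔-∘ Holds-release i φ χ))

open Equivalence using (to; from)

-- First-order formulas

module FirstOrder (S : Signature) where
  open Logic S

  module _ {Var : Sort → Set} where

    allVars-true   : ∀ {s} (t : Term Var s) → T (allVars (λ _ → true) t)
    allVarses-true : ∀ {ss} (ts : All (Term Var) ss) → T (allVarses (λ _ → true) ts)
    allVars-true (var x)      = tt
    allVars-true (app f ts)   = allVarses-true ts
    allVarses-true []         = tt
    allVarses-true (t ∷ ts)   = from T-∧ (allVars-true t , allVarses-true ts)

    allVarsᵃ-true : ∀ (a : Atom Var) → T (allVarsᵃ (λ _ → true) a)
    allVarsᵃ-true (rel p ts) = allVarses-true ts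
    allVarsᵃ-true (t ≐ u)    = from T-∧ (allVars-true t , allVars-true u)

    module _ {p q : ∀ {s} → Var s → Bool} where
      both : ∀ {s} → Var s → Bool
      both x = p x ∧ q x

      allVars-both   : ∀ {s} (t : Term Var s) →
                       T (allVars p t) → T (allVars q t) → T (allVars both t)
      allVarses-both : ∀ {ss} (ts : All (Term Var) ss) →
                       T (allVarses p ts) → T (allVarses q ts) → T (allVarses both ts)
      allVars-both (var x)    px qx = from T-∧ (px , qx)
      allVars-both (app f ts) ps qs = allVarses-both ts ps qs
      allVarses-both []       ps qs = tt
      allVarses-both (t ∷ ts) ps qs = from T-∧
        ( allVars-both t (proj₁ (to T-∧ ps)) (proj₁ (to T-∧ qs))
        , allVarses-both ts (proj₂ (to (T-∧ {allVars p t}) ps)) (proj₂ (to (T-∧ {allVars q t}) qs)))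

      allVarsᵃ-both : ∀ (a : Atom Var) → T (allVarsᵃ p a) → T (allVarsᵃ q a) → T (allVarsᵃ both a)
      allVarsᵃ-both (rel _ ts) ps qs = allVarses-both ts ps qs
      allVarsᵃ-both (t ≐ u)    ps qs = from T-∧
        ( allVars-both t (proj₁ (to T-∧ ps)) (proj₁ (to T-∧ qs))
        , allVars-both u (proj₂ (to (T-∧ {allVars p t}) ps)) (proj₂ (to (T-∧ {allVars q t}) qs)))

  module _ (M : Structure) where
    open Structure M

    module _ {Var : Sort → Set} (p : ∀ {s} → Var s → Bool)
             {ρ? : ∀ {s} → Var s → Maybe (Carrier s)} {ρ : ∀ {s} → Var s → Carrier s}
             (defined : ∀ {s} (x : Var s) → T (p x) → ρ? x ≡ just (ρ x)) where

      ⟦⟧?-defined  : ∀ {s} (t : Term Var s) → T (allVars p t) →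
                     ⟦_⟧? M (λ {s} → ρ? {s}) t ≡ just (⟦_⟧ M (λ {s} → ρ {s}) t)
      ⟦⟧*?-defined : ∀ {ss} (ts : All (Term Var) ss) → T (allVarses p ts) →
                     ⟦_⟧*? M (λ {s} → ρ? {s}) ts ≡ just (⟦_⟧* M (λ {s} → ρ {s}) ts)
      ⟦⟧?-defined (var x)    px = defined x px
      ⟦⟧?-defined (app f ts) ps rewrite ⟦⟧*?-defined ts ps = refl
      ⟦⟧*?-defined []        ps = refl
      ⟦⟧*?-defined (t ∷ ts)  ps
        rewrite ⟦⟧?-defined t (proj₁ (to T-∧ ps))
              | ⟦⟧*?-defined ts (proj₂ (to (T-∧ {allVars p t}) ps)) = refl

      HoldsAtom?-defined : ∀ a → T (allVarsᵃ p a) →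
                           HoldsAtom? M (λ {s} → ρ? {s}) a ≡ HoldsAtom M (λ {s} → ρ {s}) a
      HoldsAtom?-defined (rel r ts) ps rewrite ⟦⟧*?-defined ts ps = refl
      HoldsAtom?-defined (t ≐ u)    ps
        rewrite ⟦⟧?-defined t (proj₁ (to T-∧ ps))
              | ⟦⟧?-defined u (proj₂ (to (T-∧ {allVars p t}) ps)) = refl

    module _ {Var Var′ : Sort → Set} (p : ∀ {s} → Var s → Bool) (f : ∀ {s} → Var s → Var′ s)
             {ρ′ : ∀ {s} → Var′ s → Carrier s} {ρ : ∀ {s} → Var s → Carrier s}
             (agree : ∀ {s} (x : Var s) → T (p x) → ρ′ (f x) ≡ ρ x) where

      ⟦⟧-map  : ∀ {s} (t : Term Var s) → T (allVars p t) →
                ⟦_⟧ M (λ {s} → ρ′ {s}) (mapTerm f t) ≡ ⟦_⟧ M (λ {s} → ρ {s}) t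
      ⟦⟧*-map : ∀ {ss} (ts : All (Term Var) ss) → T (allVarses p ts) →
                ⟦_⟧* M (λ {s} → ρ′ {s}) (mapTerms f ts) ≡ ⟦_⟧* M (λ {s} → ρ {s}) ts
      ⟦⟧-map (var x)    px = agree x px
      ⟦⟧-map (app g ts) ps = cong ⟦ g ⟧ᶠ (⟦⟧*-map ts ps)
      ⟦⟧*-map []        ps = refl
      ⟦⟧*-map (t ∷ ts)  ps =
        cong₂ _∷_ (⟦⟧-map t (proj₁ (to T-∧ ps))) (⟦⟧*-map ts (proj₂ (to (T-∧ {allVars p t}) ps)))

      HoldsAtom-map : ∀ a → T (allVarsᵃ p a) →
                      HoldsAtom M (λ {s} → ρ′ {s}) (mapAtom f a) ≡ HoldsAtom M (λ {s} → ρ {s}) a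
      HoldsAtom-map (rel r ts) ps = cong ⟦ r ⟧ᵖ (⟦⟧*-map ts ps)
      HoldsAtom-map (t ≐ u)    ps =
        cong₂ _≡_ (⟦⟧-map t (proj₁ (to T-∧ ps))) (⟦⟧-map u (proj₂ (to (T-∧ {allVars p t}) ps)))

    ⊨-rename : ∀ {Γ Δ} (r : Renaming Γ Δ) {ρ : Env M Γ} {ρ′ : Env M Δ} →
               (∀ {s} (x : s ∈ Γ) → All.lookup ρ′ (r x) ≡ All.lookup ρ x) →
               ∀ φ → _⊨_ M ρ′ (rename r φ) ⇔ _⊨_ M ρ φ
    ⊨-rename-lift : ∀ {Γ Δ} (r : Renaming Γ Δ) {ρ : Env M Γ} {ρ′ : Env M Δ} →
                    (∀ {s} (x : s ∈ Γ) → All.lookup ρ′ (r x) ≡ All.lookup ρ x) →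
                    ∀ {s} (φ : Formula (s ∷ Γ)) (c : Carrier s) →
                    _⊨_ M (c ∷ ρ′) (rename (lift r) φ) ⇔ _⊨_ M (c ∷ ρ) φ
    ⊨-rename r h ⊤′        = ⇔-id _
    ⊨-rename r h ⊥′        = ⇔-id _
    ⊨-rename r h (atom′ a) = ≡⇒⇔ (HoldsAtom-map (λ _ → true) r (λ x _ → h x) a (allVarsᵃ-true a))
    ⊨-rename r h (¬′ φ)    = ¬-cong-⇔ (⊨-rename r h φ)
    ⊨-rename r h (φ ∧′ χ)  = ⊨-rename r h φ ×-⇔ ⊨-rename r h χ
    ⊨-rename r h (φ ∨′ χ)  = ⊨-rename r h φ ⊎-⇔ ⊨-rename r h χ
    ⊨-rename r h (φ ⇒′ χ)  = →-cong-⇔ (⊨-rename r h φ) (⊨-rename r h χ)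
    ⊨-rename r h (∀′ s φ)  = mk⇔ (λ f c → to (⊨-rename-lift r h φ c) (f c))
                                 (λ f c → from (⊨-rename-lift r h φ c) (f c))
    ⊨-rename r h (∃′ s φ)  = mk⇔ (λ (c , v) → c , to (⊨-rename-lift r h φ c) v)
                                 (λ (c , v) → c , from (⊨-rename-lift r h φ c) v)
    ⊨-rename-lift r {ρ} {ρ′} h φ c =
      ⊨-rename (lift r) (λ { (here refl) → refl ; (there x) → h x }) φ

    ⊨-∀[] : ∀ Δ {Γ} (ρ : Env M Γ) (φ : Formula (Δ ++ Γ)) →
            _⊨_ M ρ (∀[ Δ ] φ) ⇔ (∀ (δ : Env M Δ) → _⊨_ M (++⁺ δ ρ) φ)
    ⊨-∀[] []      ρ φ = mk⇔ (λ { v [] → v }) (λ f → f [])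
    ⊨-∀[] (s ∷ Δ) ρ φ = mk⇔ (λ { v (c ∷ δ) → to (⊨-∀[] Δ ρ (∀′ s φ)) v δ c })
                          (λ f → from (⊨-∀[] Δ ρ (∀′ s φ)) λ δ c → f (c ∷ δ))

    ⊨-∃[] : ∀ Δ {Γ} (ρ : Env M Γ) (φ : Formula (Δ ++ Γ)) →
            _⊨_ M ρ (∃[ Δ ]′ φ) ⇔ (Σ[ δ ∈ Env M Δ ] _⊨_ M (++⁺ δ ρ) φ)
    ⊨-∃[] []      ρ φ = mk⇔ (λ v → [] , v) (λ { ([] , v) → v })
    ⊨-∃[] (s ∷ Δ) ρ φ = mk⇔
      (λ v → let δ , c , w = to (⊨-∃[] Δ ρ (∃′ s φ)) v in c ∷ δ , w)
      (λ { (c ∷ δ , w) → from (⊨-∃[] Δ ρ (∃′ s φ)) (δ , c , w) })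

    ⊨-⋁′ : ∀ {Γ} (ρ : Env M Γ) {B : Set} (f : B → Formula Γ) xs →
           _⊨_ M ρ (⋁′ (map f xs)) ⇔ (∃[ x ] (x ∈ xs × _⊨_ M ρ (f x)))
    ⊨-⋁′ ρ f xs = mk⇔ (locate xs) (λ (x , x∈xs , v) → inject xs x∈xs v)
      where
      locate : ∀ xs → _⊨_ M _ (⋁′ (map f xs)) → ∃[ x ] (x ∈ xs × _⊨_ M _ (f x))
      locate (x ∷ xs) (inj₁ v) = x , here refl , v
      locate (x ∷ xs) (inj₂ w) = let y , y∈xs , v = locate xs w in y , there y∈xs , v
      inject : ∀ xs {x} → x ∈ xs → _⊨_ M _ (f x) → _⊨_ M _ (⋁′ (map f xs))
      inject (x ∷ xs) (here refl) v = inj₁ v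
      inject (x ∷ xs) (there x∈)  v = inj₂ (inject xs x∈ v)

    ⊨-⋀′ : ∀ {Γ} (ρ : Env M Γ) {B : Set} (f : B → Formula Γ) xs →
           _⊨_ M ρ (⋀′ (map f xs)) ⇔ (∀ {x} → x ∈ xs → _⊨_ M ρ (f x))
    ⊨-⋀′ ρ f xs = mk⇔ (project xs) (collect xs)
      where
      project : ∀ xs → _⊨_ M _ (⋀′ (map f xs)) → ∀ {x} → x ∈ xs → _⊨_ M _ (f x)
      project (x ∷ xs) (v , w) (here refl) = v
      project (x ∷ xs) (v , w) (there x∈)  = project xs w x∈
      collect : ∀ xs → (∀ {x} → x ∈ xs → _⊨_ M _ (f x)) → _⊨_ M _ (⋀′ (map f xs))
      collect []       h = tt
      collect (x ∷ xs) h = h (here refl) , collect xs (h ∘ there)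

    lookup-++⁺ˡ : ∀ {Δ Γ} (δ : Env M Δ) (ρ : Env M Γ) {s} (x : s ∈ Δ) →
                  All.lookup (++⁺ δ ρ) (∈-++⁺ˡ x) ≡ All.lookup δ x
    lookup-++⁺ˡ (c ∷ δ) ρ (here refl) = refl
    lookup-++⁺ˡ (c ∷ δ) ρ (there x)   = lookup-++⁺ˡ δ ρ x

    lookup-++⁺ʳ : ∀ {Δ Γ} (δ : Env M Δ) (ρ : Env M Γ) {s} (x : s ∈ Γ) →
                  All.lookup (++⁺ δ ρ) (∈-++⁺ʳ Δ x) ≡ All.lookup ρ x
    lookup-++⁺ʳ []      ρ x = refl
    lookup-++⁺ʳ (c ∷ δ) ρ x = lookup-++⁺ʳ δ ρ x

open Equivalence using (to; from)

-- Win formulas and strategies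

module Winning (S : Signature) (X Y : List (Signature.Sort S))
               (D : Properties.Decomposition S X Y) where
  open Synthesis S X Y D
  open Decomposition D
  open FirstOrder S
  open Progression patom-dec
  open Game patom-dec

  module _ (M : Structure) (em : {P : Set} → Dec P) (ψ : Property) (ψ-free : LookbackFree ψ) where
    open Structure M
    open Semantics M

    C : List PAtom
    C = atoms ψ

    free : ∀ {a} → a ∈ C → T (allVarsᵃ is-current a)
    free a∈C = All.lookup ψ-free a∈C

    -- Lookback variables get a junk value: they do not occur in ψ.
    present : Env M V → ∀ {s} → Variable s → Carrier s
    present α (current x)  = All.lookup α x
    present α (lookback x) = All.lookup α x

    Fact : Env M V → PAtom → Set
    Fact α = HoldsAtom M (present α)

    truth : Env M V → PAtom → Bool
    truth α a = does (em {Fact α a})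

    truth-correct : ∀ α a → Fact α a ⇔ T (truth α a)
    truth-correct α a = ⇔-sym (T-does em)

    σ : Env M X → Env M Y → PAtom → Bool
    σ β γ = truth (++⁺ β γ)

    -- Lookback-freeness makes the atoms of ψ defined at every instant, the first included, and
    -- independent of the preceding assignment. Hence σ is the same function in every round.
    HoldsNow-truth : ∀ b α {a} → a ∈ C → HoldsNow b α a ⇔ T (truth α a)
    HoldsNow-truth b α {a} a∈C = truth-correct α a ⇔-∘ ≡⇒⇔
      (HoldsAtom?-defined M is-current {valueOf b α} {present α} (λ { (current x) _ → refl })
                          a (free a∈C))

    HoldsBoolean-evaluate : ∀ b α φ → (∀ {a} → a ∈ atomsᵇ φ → a ∈ C) →
                            HoldsBoolean b α φ ⇔ T (evaluate (truth α) φ)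
    HoldsBoolean-evaluate b α ttᵇ      ⊆C = ⇔-id _
    HoldsBoolean-evaluate b α ffᵇ      ⊆C = ⇔-id _
    HoldsBoolean-evaluate b α (posᵇ a) ⊆C = HoldsNow-truth b α (⊆C (here refl))
    HoldsBoolean-evaluate b α (negᵇ a) ⊆C =
      ⇔-sym T-not ⇔-∘ ¬-cong-⇔ (HoldsNow-truth b α (⊆C (here refl)))
    HoldsBoolean-evaluate b α (φ ∧ᵇ χ) ⊆C = ⇔-sym T-∧ ⇔-∘
      (HoldsBoolean-evaluate b α φ (⊆C ∘ ∈-++⁺ˡ) ×-⇔
       HoldsBoolean-evaluate b α χ (⊆C ∘ ∈-++⁺ʳ (atomsᵇ φ)))
    HoldsBoolean-evaluate b α (φ ∨ᵇ χ) ⊆C = ⇔-sym T-∨ ⇔-∘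
      (HoldsBoolean-evaluate b α φ (⊆C ∘ ∈-++⁺ˡ) ⊎-⇔
       HoldsBoolean-evaluate b α χ (⊆C ∘ ∈-++⁺ʳ (atomsᵇ φ)))

    -- `p` delimits the variables on which ρ has to agree with α: `is-current` at OR-nodes, and
    -- `not-Y` as well at AND-nodes, where `atAnd` sends the current Y-variables to arbitrary
    -- places.
    toFormula-evaluate :
      ∀ {Γ} (r : ∀ {s} → Variable s → s ∈ Γ) (ρ : Env M Γ) α (p : ∀ {s} → Variable s → Bool) →
      (∀ {s} (x : Variable s) → T (p x) → All.lookup ρ (r x) ≡ present α x) →
      ∀ φ → (∀ {a} → a ∈ atomsᵇ φ → T (allVarsᵃ p a)) →
      _⊨_ M ρ (toFormula r φ) ⇔ T (evaluate (truth α) φ)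
    toFormula-evaluate r ρ α p agree = go
      where
      go : ∀ φ → (∀ {a} → a ∈ atomsᵇ φ → T (allVarsᵃ p a)) →
           _⊨_ M ρ (toFormula r φ) ⇔ T (evaluate (truth α) φ)
      literal : ∀ a → T (allVarsᵃ p a) → HoldsAtom M (All.lookup ρ) (mapAtom r a) ⇔ T (truth α a)
      literal a pa = truth-correct α a ⇔-∘ ≡⇒⇔ (HoldsAtom-map M p r agree a pa)
      go ttᵇ      h = ⇔-id _
      go ffᵇ      h = ⇔-id _
      go (posᵇ a) h = literal a (h (here refl))
      go (negᵇ a) h = ⇔-sym T-not ⇔-∘ ¬-cong-⇔ (literal a (h (here refl)))
      go (φ ∧ᵇ χ) h = ⇔-sym T-∧ ⇔-∘ (go φ (h ∘ ∈-++⁺ˡ) ×-⇔ go χ (h ∘ ∈-++⁺ʳ (atomsᵇ φ)))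
      go (φ ∨ᵇ χ) h = ⇔-sym T-∨ ⇔-∘ (go φ (h ∘ ∈-++⁺ˡ) ⊎-⇔ go χ (h ∘ ∈-++⁺ʳ (atomsᵇ φ)))

    module _ (β : Env M X) (γ : Env M Y) (ρ : Env M V) where

      lookup-now : ∀ {s} (x : s ∈ V) →
                   All.lookup (++⁺ γ (++⁺ β ρ)) (now x) ≡ All.lookup (++⁺ β γ) x
      -- Matching on `++⁺∘++⁻` replaces x by the injection of the part it lies in, where the lookup
      -- lemmas apply.
      lookup-now x with ∈-++⁻ X x | ++⁺∘++⁻ X x
      ... | inj₁ x∈X | refl = trans (lookup-++⁺ʳ M γ (++⁺ β ρ) (∈-++⁺ˡ x∈X))
                                (trans (lookup-++⁺ˡ M β ρ x∈X) (sym (lookup-++⁺ˡ M β γ x∈X)))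
      ... | inj₂ y∈Y | refl = trans (lookup-++⁺ˡ M γ (++⁺ β ρ) y∈Y) (sym (lookup-++⁺ʳ M β γ y∈Y))

      lookup-atOr : ∀ {s} (x : Variable s) → T (is-current x) →
                    All.lookup (++⁺ γ (++⁺ β ρ)) (atOr x) ≡ present (++⁺ β γ) x
      lookup-atOr (current x) _ = lookup-now x

      lookup-atAnd : ∀ {s} (x : Variable s) → T (not-Y x ∧ is-current x) →
                     All.lookup (++⁺ β ρ) (atAnd x) ≡ present (++⁺ β γ) x
      lookup-atAnd (current x) h with ∈-++⁻ X x | ++⁺∘++⁻ X x
      lookup-atAnd (current x) h  | inj₁ x∈X | refl =
        trans (lookup-++⁺ˡ M β ρ x∈X) (sym (lookup-++⁺ˡ M β γ x∈X))

    C-env⊆C : ∀ {a} → a ∈ C-env ψ → a ∈ C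
    C-env⊆C a∈ = proj₁ (∈-filter⁻ (λ a → T? (allVarsᵃ not-Y a)) {xs = C} a∈)

    C-ag⊆C : ∀ {a} → a ∈ C-ag ψ → a ∈ C
    C-ag⊆C a∈ = proj₁ (∈-filter⁻ (λ a → T? (not (allVarsᵃ not-Y a))) {xs = C} a∈)

    C-cover : ∀ {a} → a ∈ C → a ∈ C-env ψ ⊎ a ∈ C-ag ψ
    C-cover {a} a∈ with T? (allVarsᵃ not-Y a)
    ... | yes t = inj₁ (∈-filter⁺ (λ a → T? (allVarsᵃ not-Y a)) a∈ t)
    ... | no ¬t = inj₂ (∈-filter⁺ (λ a → T? (not (allVarsᵃ not-Y a))) a∈ (from T-not ¬t))

    envDec : ∀ s → IsDecomposition (xnf s) (C-env ψ) (decomp (xnf s) (C-env ψ))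
    envDec s = isDecomposition (xnf-XNF s) (C-env ψ)

    agDec : ∀ s → IsDecomposition (xnf s) (C-ag ψ) (decomp (xnf s) (C-ag ψ))
    agDec s = isDecomposition (xnf-XNF s) (C-ag ψ)

    env-atoms : ∀ {s w t} → (w , t) ∈ decomp (xnf s) (C-env ψ) →
                ∀ {a} → a ∈ atomsᵇ w → a ∈ C-env ψ
    env-atoms {s} = IsDecomposition.prm-atoms (envDec s)

    or-atoms : ∀ {t ς u} → (ς , u) ∈ orEdges ψ t → ∀ {a} → a ∈ atomsᵇ ς → a ∈ C
    or-atoms {t} t→u with ∈-map⁻ _ t→u
    ... | _ , ∈ds , refl = C-ag⊆C ∘ IsDecomposition.prm-atoms (agDec t) ∈ds

    step-progress : ∀ {s w t ς u} → (w , t) ∈ decomp (xnf s) (C-env ψ) → (ς , u) ∈ orEdges ψ t →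
                    ∀ τ → T (evaluate τ w) → T (evaluate τ ς) → u ≡ₚ progress C τ s
    step-progress {s} {t = t} s→t t→u τ w-true ς-true with ∈-map⁻ _ t→u
    ... | _ , ∈ds , refl =
      edges-progress {s} {t} C-env⊆C C-ag⊆C C-cover (envDec s) (agDec t) s→t ∈ds τ
        (to T-≡ w-true) (to T-≡ ς-true)

    answer-edge : ∀ t τ → ∃[ ς ] ∃[ u ] ((ς , u) ∈ orEdges ψ t × T (evaluate τ ς))
    answer-edge t τ =
      let ς , sub , ∈ds , eq = some-edge (agDec t) τ
      in ς , xnf (rmX sub) , ∈-map⁺ _ ∈ds , from T-≡ eq

    env-edge : ∀ s τ → ∃[ w ] ∃[ t ] ((w , t) ∈ decomp (xnf s) (C-env ψ) × T (evaluate τ w))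
    env-edge s τ =
      let w , t , ∈ds , eq = some-edge (envDec s) τ in w , t , ∈ds , from T-≡ eq

    andEdges-nonfinal : ∀ {s} → ¬ Final s → andEdges ψ s ≡ decomp (xnf s) (C-env ψ)
    andEdges-nonfinal {s} nonfinal =
      cong (λ b → if b then [] else decomp (xnf s) (C-env ψ)) (dec-false (final? s) nonfinal)

    W : ℕ → Label → Set
    W = Wins C σ

    -- The formula is read where Y is not bound yet; it can match the evaluation at every γ because
    -- w has no Y-variables.
    w-formula : ∀ {s w t} → (w , t) ∈ decomp (xnf s) (C-env ψ) → ∀ β γ ρ →
                _⊨_ M (++⁺ β ρ) (toFormula atAnd w) ⇔ T (evaluate (σ β γ) w)
    w-formula {s} {w} s→t β γ ρ =
      toFormula-evaluate atAnd (++⁺ β ρ) (++⁺ β γ) (λ x → not-Y x ∧ is-current x)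
        (lookup-atAnd β γ ρ) w λ {a} a∈w →
          let a∈Cenv = env-atoms {s} s→t a∈w in
          allVarsᵃ-both a (proj₂ (∈-filter⁻ (λ a → T? (allVarsᵃ not-Y a)) {xs = C} a∈Cenv))
                          (free (C-env⊆C a∈Cenv))

    ς-formula : ∀ {t ς u} → (ς , u) ∈ orEdges ψ t → ∀ β γ ρ →
                _⊨_ M (++⁺ γ (++⁺ β ρ)) (toFormula atOr ς) ⇔ T (evaluate (σ β γ) ς)
    ς-formula {t} {ς} t→u β γ ρ =
      toFormula-evaluate atOr (++⁺ γ (++⁺ β ρ)) (++⁺ β γ) is-current
        (lookup-atOr β γ ρ) ς λ a∈ς → free (or-atoms {t} t→u a∈ς)

    module _ (i : ℕ) (ih : ∀ (ρ : Env M V) u → _⊨_ M ρ (Win ψ i u) ⇔ W i u) where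

      branch : Boolean PAtom × Label → Formula (X ++ V)
      branch (ς , u) = ∃[ Y ]′ (toFormula atOr ς ∧′ rename now (Win ψ i u))

      branch-Wins : ∀ ρ β {t ς u} → (ς , u) ∈ orEdges ψ t →
                    _⊨_ M (++⁺ β ρ) (branch (ς , u)) ⇔ (∃[ γ ] (T (evaluate (σ β γ) ς) × W i u))
      branch-Wins ρ β {t} {ς} {u} t→u =
        mk⇔ (λ (γ , v) → γ , to (parts γ) v) (λ (γ , w) → γ , from (parts γ) w)
        ⇔-∘ ⊨-∃[] M Y (++⁺ β ρ) _
        where
        parts : ∀ γ → _⊨_ M (++⁺ γ (++⁺ β ρ)) (toFormula atOr ς ∧′ rename now (Win ψ i u)) ⇔
                (T (evaluate (σ β γ) ς) × W i u)
        parts γ = ς-formula {t} t→u β γ ρ ×-⇔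
                  (ih (++⁺ β γ) u ⇔-∘ ⊨-rename M now (lookup-now β γ ρ) (Win ψ i u))

      Pre′-Wins : ∀ ρ β t → _⊨_ M (++⁺ β ρ) (Pre′ ψ (Win ψ i) t) ⇔
                  (∃[ γ ] ∃[ ς ] ∃[ u ] ((ς , u) ∈ orEdges ψ t × T (evaluate (σ β γ) ς) × W i u))
      Pre′-Wins ρ β t = mk⇔
        (λ { ((ς , u) , t→u , v) → let γ , ς-true , w = to (branch-Wins ρ β {t} t→u) v
                                   in γ , ς , u , t→u , ς-true , w })
        (λ (γ , ς , u , t→u , ς-true , w) →
           (ς , u) , t→u , from (branch-Wins ρ β {t} t→u) (γ , ς-true , w))
        ⇔-∘ ⊨-⋁′ M (++⁺ β ρ) branch (orEdges ψ t)

      -- Exhaustiveness provides edges for every round, and every pair of edges whose guards are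
      -- true leads to the progressed label up to `≡ₚ`. A final node has no edges, so there the
      -- conjunction would be empty.
      Pre-Wins : ∀ ρ s → ¬ Final s →
                 _⊨_ M ρ (Pre ψ (Win ψ i) s) ⇔ (∀ β → ∃[ γ ] W i (after C σ β γ s))
      Pre-Wins ρ s nonfinal = mk⇔ forward backward ⇔-∘
        ≡⇒⇔ (cong (λ es → _⊨_ M ρ (⋀′ (map f es))) (andEdges-nonfinal {s} nonfinal))
        where
        edges = decomp (xnf s) (C-env ψ)
        f : Boolean PAtom × Label → Formula V
        f (w , t) = ∀[ X ] (toFormula atAnd w ⇒′ Pre′ ψ (Win ψ i) t)
        forward : _⊨_ M ρ (⋀′ (map f edges)) → ∀ β → ∃[ γ ] W i (after C σ β γ s)
        forward v β =
          -- An arbitrary answer serves to find the edge that the environment takes; the truth of w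
          -- then carries over to the answer γ obtained from it.
          let γ₀ = All.universal inhabited Y
              w , t , s→t , w-true = env-edge s (σ β γ₀)
              v-w = from (w-formula {s} s→t β γ₀ ρ) w-true
              γ , ς , u , t→u , ς-true , win = to (Pre′-Wins ρ β t)
                (to (⊨-∀[] M X ρ _) (to (⊨-⋀′ M ρ f edges) v s→t) β v-w)
          in γ , Wins-resp C σ i (step-progress {s} s→t t→u (σ β γ)
                                   (to (w-formula {s} s→t β γ ρ) v-w) ς-true) win
        backward : (∀ β → ∃[ γ ] W i (after C σ β γ s)) → _⊨_ M ρ (⋀′ (map f edges))
        backward wins = from (⊨-⋀′ M ρ f edges) λ { {w , t} s→t → from (⊨-∀[] M X ρ _) λ β v-w →
          let γ , win = wins β
              ς , u , t→u , ς-true = answer-edge t (σ β γ)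
          in from (Pre′-Wins ρ β t) (γ , ς , u , t→u , ς-true ,
               Wins-resp C σ i (λ ν → sym (step-progress {s} s→t t→u (σ β γ)
                                             (to (w-formula {s} s→t β γ ρ) v-w) ς-true ν)) win) }

    -- The right-hand side does not mention ρ: without lookback a Win formula does not depend on the
    -- values of its free variables, so the rounds decouple.
    Win-Wins : ∀ i ρ s → _⊨_ M ρ (Win ψ i s) ⇔ W i s
    Win-Wins zero ρ s with final? s
    ... | yes fin = mk⇔ (λ _ → fin) λ _ →
      subst (λ b → _⊨_ M ρ (if b then ⊤′ else ⊥′)) (sym (dec-true (final? s) fin)) tt
    ... | no ¬fin = mk⇔
      (λ v → ⊥-elim (subst (λ b → _⊨_ M ρ (if b then ⊤′ else ⊥′)) (dec-false (final? s) ¬fin) v))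
      (λ fin → contradiction fin ¬fin)
    Win-Wins (suc i) ρ s with em {Final s}
    ... | yes fin = mk⇔ (λ _ → Final⇒Wins C σ (suc i) fin)
                        (λ _ → inj₁ (from (Win-Wins i ρ s) (Final⇒Wins C σ i fin)))
    ... | no ¬fin = Win-Wins i ρ s ⊎-⇔ Pre-Wins i (Win-Wins i) ρ s ¬fin

    module _ (h : Strategy) (π : ℕ → Env M X) where
      open Play h π

      label : ℕ → Label
      label = labelAt C σ (s₀ ψ) h π

      open Unrolling patom-dec C (truth ∘ play)

      label-value : ∀ n {ν} → ν (pos last) ≡ true →
                    (prefix (suc n) ⊨ᵗ ψ) ⇔ T (value ν (label (suc n)))
      label-value n {ν} ν-last =
        ≡⇒⇔ (cong T (sym (value-unroll label (λ _ → refl) (suc n) ν)))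
        ⇔-∘ Traces.Holds⇔value S X Y M (prefix (suc n)) C (truth ∘ play)
              (λ i a∈C → HoldsNow-truth _ _ a∈C) ν-last n Fin.zero refl ψ (λ a∈ → a∈)

      -- By `label-value` the label reached has one and the same value at all valuations with `last`
      -- true, so its truth at a single one of them makes it final.
      Final⇔models : ∀ n → Final (label (suc n)) ⇔ (prefix (suc n) ⊨ᵗ ψ)
      Final⇔models n = mk⇔
        (λ fin → from (label-value n {λ _ → true} refl) (from T-≡ (fin (λ _ → true) refl)))
        (λ models ν ν-last → to T-≡ (to (label-value n ν-last) models))

    setLast : Valuation Proposition → Valuation Proposition
    setLast ν (pos last) = true
    setLast ν φ          = ν φ

    value-setLast : ∀ ν (φ : Property) → value (setLast ν) (mapLTL atom φ) ≡ value ν (mapLTL atom φ)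
    value-setLast ν tt            = refl
    value-setLast ν ff            = refl
    value-setLast ν (pos a)       = refl
    value-setLast ν (neg a)       = refl
    value-setLast ν (φ and χ)     = cong₂ _∧_ (value-setLast ν φ) (value-setLast ν χ)
    value-setLast ν (φ or χ)      = cong₂ _∨_ (value-setLast ν φ) (value-setLast ν χ)
    value-setLast ν (next φ)      = refl
    value-setLast ν (wnext φ)     = refl
    value-setLast ν (φ until χ)   = refl
    value-setLast ν (φ release χ) = refl

    -- `last` does not occur in ψ, so ψ can only be final by being valid.
    Final-s₀ : ∀ τ → Final (s₀ ψ) → Final (progress C τ (s₀ ψ))
    Final-s₀ τ fin ν _ = trans (value-progress C τ ν (s₀ ψ))
      (trans (sym (value-setLast (pull C τ ν) ψ)) (fin (setLast (pull C τ ν)) refl))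

    module _ (K : ℕ) (g : Strategy) (π : ℕ → Env M X) where
      open Play g π

      w-played : ∀ k {s w t} → (w , t) ∈ decomp (xnf s) (C-env ψ) →
                 HoldsBoolean (playBefore k) (play k) w ⇔ T (evaluate (truth (play k)) w)
      w-played k {s} {w} s→t =
        HoldsBoolean-evaluate (playBefore k) (play k) w (C-env⊆C ∘ env-atoms {s} s→t)

      ς-played : ∀ k {t ς u} → (ς , u) ∈ orEdges ψ t →
                 HoldsBoolean (playBefore k) (play k) ς ⇔ T (evaluate (truth (play k)) ς)
      ς-played k {t} {ς} t→u =
        HoldsBoolean-evaluate (playBefore k) (play k) ς (or-atoms {t} t→u)

      move-progress : ∀ {k s u} → ¬ Final s → Move ψ M K g π k s u →
                      u ≡ₚ progress C (truth (play k)) s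
      move-progress {k} {s} nonfinal move =
        step-progress {s} s→t′ t→u (truth (play k))
          (to (w-played k {s} s→t′) w-true) (to (ς-played k {t} t→u) ς-true)
        where
        open Move move
        s→t′ : (w , t) ∈ decomp (xnf s) (C-env ψ)
        s→t′ = subst ((w , t) ∈_) (andEdges-nonfinal {s} nonfinal) s→t

      some-move : ∀ k s → ¬ Final s → W (K ∸ k) (progress C (truth (play k)) s) →
                  ∃[ u ] Move ψ M K g π k s u
      some-move k s nonfinal wins =
        let τ = truth (play k)
            w , t , s→t , w-true = env-edge s τ
            ς , u , t→u , ς-true = answer-edge t τ
        in u , record
          { s→t    = subst ((w , t) ∈_) (sym (andEdges-nonfinal {s} nonfinal)) s→t
          ; w-true = from (w-played k {s} s→t) w-true
          ; t→u    = t→u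
          ; ς-true = from (ς-played k {t} t→u) ς-true
          ; wins   = from (Win-Wins (K ∸ k) (play k) u) (Wins-resp C σ (K ∸ k)
              (λ ν → sym (step-progress {s} s→t t→u τ w-true ς-true ν)) wins)
          }

      reaches-label : ∀ {k s} → Reaches ψ M K g π k s → s ≡ₚ label g π k
      reaches-label start ν = refl
      reaches-label (step {k} {s} {u} reach nonfinal move) ν =
        trans (move-progress nonfinal move ν)
              (progress-cong C (truth (play k)) {s} {label g π k} (reaches-label reach) ν)

      -- A move in round k leads to a node with `Win (K ∸ k)`, which is already round `suc k`; hence
      -- the `suc K`, which at the start merely weakens the assumption.
      reaches-wins : W K (s₀ ψ) → ∀ {k s} → Reaches ψ M K g π k s → W (suc K ∸ k) s
      reaches-wins win start = inj₁ win
      reaches-wins win (step {k} {u = u} reach nonfinal move) =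
        to (Win-Wins (K ∸ k) (play k) u) (Move.wins move)

      finish : ∀ k {s} → Reaches ψ M K g π (suc k) s → Final s → prefix (suc k) ⊨ᵗ ψ
      finish k {s} reach fin =
        to (Final⇔models g π k) (Final-resp {s} {label g π (suc k)} (reaches-label reach) fin)

    -- Truncated subtraction does no harm: once `suc K ∸ k` is zero, winning means being final,
    -- which is excluded.
    Wins-pred : ∀ K k {s} → W (suc K ∸ k) s → ¬ Final s → ∀ β → ∃[ γ ] W (K ∸ k) (after C σ β γ s)
    Wins-pred K       zero          win nonfinal = Wins-step C σ K win nonfinal
    Wins-pred zero    (suc zero)    win nonfinal = contradiction win nonfinal
    Wins-pred zero    (suc (suc k)) win nonfinal = contradiction win nonfinal
    Wins-pred (suc K) (suc k)       win nonfinal = Wins-pred K k win nonfinal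

    -- A move in round K leads to a node with `Win zero`, that is, a final one, so play stops by
    -- then at the latest.
    IsG-realizes : ∀ K g → IsG ψ M K g → Realizes g ψ
    IsG-realizes K g isG π with em {Final (s₀ ψ)}
    -- Here play stops before any round, but a trace has at least one instant, so satisfaction is
    -- shown after whatever g answers first.
    ... | yes fin     = 0 , to (Final⇔models g π 0) (Final-s₀ _ fin)
    ... | no nonfinal = run K 0 refl start nonfinal
      where
      open Play g π
      run : ∀ n k → k + n ≡ K → ∀ {s} → Reaches ψ M K g π k s → ¬ Final s →
            ∃[ k ] (prefix (suc k) ⊨ᵗ ψ)
      run n k k+n≡K reach nonfinal with isG π reach nonfinal
      ... | u , move with em {Final u}
      ...   | yes fin = k , finish K g π k (step reach nonfinal move) fin
      run zero    k k≡K   reach nonfinal | u , move | no ¬fin =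
        contradiction (subst (λ i → W i u) K∸k≡0
          (to (Win-Wins (K ∸ k) (play k) u) (Move.wins move))) ¬fin
        where
        K∸k≡0 : K ∸ k ≡ 0
        K∸k≡0 = trans (cong (K ∸_) (trans (sym (+-identityʳ k)) k≡K)) (n∸n≡0 K)
      run (suc n) k k+n≡K reach nonfinal | u , move | no ¬fin =
        run n (suc k) (trans (sym (+-suc k n)) k+n≡K) (step reach nonfinal move) ¬fin

    -- `optimal` follows progressed labels, whereas the graph visits labels that are only equivalent
    -- to them; winning is carried to the progressed label and back along `reaches-label`.
    IsG-exists : ∀ K → W K (s₀ ψ) → ∃ (IsG ψ M K)
    IsG-exists K win = optimal , λ π {k} {s} reach nonfinal →
      let open Play optimal π
          s≡ₚlabel = reaches-label K optimal π reach
          γ , win′ = Wins-pred K k {s} (reaches-wins K optimal π win reach) nonfinal (π k)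
      in some-move K optimal π k s nonfinal
           (Wins-resp C σ (K ∸ k)
             (λ ν → sym (progress-cong C (truth (play k)) {s} {label optimal π k} s≡ₚlabel ν))
             (optimal-wins π k (γ , Wins-resp C σ (K ∸ k)
               (progress-cong C (σ (π k) γ) {s} {label optimal π k} s≡ₚlabel) win′)))
      where open Optimal C σ em (s₀ ψ) (All.universal inhabited Y) K

    W⇒GRealizesIn : ∀ K → W K (s₀ ψ) → GRealizesIn ψ M K
    W⇒GRealizesIn K win = IsG-exists K win , IsG-realizes K

    -- By contraposition: from a lost label `evade` produces environment choices against the given
    -- strategy along which no prefix satisfies ψ.
    RealizableIn⇒W : RealizableIn ψ → W (bound (s₀ ψ)) (s₀ ψ)
    RealizableIn⇒W (h , realizes) = decidable-stable em λ lost →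
      let π , nonfinal  = evade C σ em (s₀ ψ) (All.universal inhabited X) h lost
          k , models    = realizes π
      in nonfinal (suc k) (from (Final⇔models h π k) models)

    W-stable : ∀ i → W i (s₀ ψ) → W (bound (s₀ ψ)) (s₀ ψ)
    W-stable i = Wins-stable C σ em (s₀ ψ) {i} (s₀-supported C σ em (s₀ ψ))

open Equivalence using (to; from)

-- The decision procedure

classical₀ : Classical → {P : Set} → Dec P
classical₀ em = map′ Level.lower Level.lift em

sublists : ∀ {A : Set} → List A → List (List A)
sublists []       = [] ∷ []
sublists (x ∷ xs) = map (x ∷_) (sublists xs) ++ sublists xs

filter∈sublists : ∀ {A : Set} {P : A → Set} (P? : ∀ x → Dec (P x)) xs → filter P? xs ∈ sublists xs
filter∈sublists P? [] = here refl
filter∈sublists P? (x ∷ xs) with does (P? x)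
... | true  = ∈-++⁺ˡ (∈-map⁺ (x ∷_) (filter∈sublists P? xs))
... | false = ∈-++⁺ʳ (map (x ∷_) (sublists xs)) (filter∈sublists P? xs)

module Deciding (S : Signature) (X Y : List (Signature.Sort S))
                (D : Properties.Decomposition S X Y) where
  open Synthesis S X Y D
  open FirstOrder S
  open Progression patom-dec
  open Game patom-dec
  open Winning S X Y D
  open import Data.List.Membership.DecPropositional patom-dec using (_∈?_)

  QuantifierFree-rename : ∀ {Γ Δ} (r : Renaming Γ Δ) φ →
                          QuantifierFree φ → QuantifierFree (rename r φ)
  QuantifierFree-rename r ⊤′        qf        = tt
  QuantifierFree-rename r ⊥′        qf        = tt
  QuantifierFree-rename r (atom′ a) qf        = tt
  QuantifierFree-rename r (¬′ φ)    qf        = QuantifierFree-rename r φ qf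
  QuantifierFree-rename r (φ ∧′ χ)  (qf , qg) =
    QuantifierFree-rename r φ qf , QuantifierFree-rename r χ qg
  QuantifierFree-rename r (φ ∨′ χ)  (qf , qg) =
    QuantifierFree-rename r φ qf , QuantifierFree-rename r χ qg
  QuantifierFree-rename r (φ ⇒′ χ)  (qf , qg) =
    QuantifierFree-rename r φ qf , QuantifierFree-rename r χ qg

  QuantifierFree-toFormula : ∀ {Γ} (r : ∀ {s} → Variable s → s ∈ Γ) φ →
                             QuantifierFree (toFormula r φ)
  QuantifierFree-toFormula r ttᵇ      = tt
  QuantifierFree-toFormula r ffᵇ      = tt
  QuantifierFree-toFormula r (posᵇ a) = tt
  QuantifierFree-toFormula r (negᵇ a) = tt
  QuantifierFree-toFormula r (φ ∧ᵇ χ) = QuantifierFree-toFormula r φ , QuantifierFree-toFormula r χ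
  QuantifierFree-toFormula r (φ ∨ᵇ χ) = QuantifierFree-toFormula r φ , QuantifierFree-toFormula r χ

  ∃*-∃[] : ∀ Δ {Γ} (φ : Formula (Δ ++ Γ)) → ∃* φ → ∃* (∃[ Δ ]′ φ)
  ∃*-∃[] []      φ e = e
  ∃*-∃[] (s ∷ Δ) φ e = ∃*-∃[] Δ (∃′ s φ) (∃-step e)

  ∀*∃*-∀[] : ∀ Δ {Γ} (φ : Formula (Δ ++ Γ)) → ∀*∃* φ → ∀*∃* (∀[ Δ ] φ)
  ∀*∃*-∀[] []      φ a = a
  ∀*∃*-∀[] (s ∷ Δ) φ a = ∀*∃*-∀[] Δ (∀′ s φ) (∀-step a)

  module _ (ψ : Property) where

    -- An outcome lists the atoms that are true in a round; a goal lists the outcomes among which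
    -- the agent wants the round to end.
    Outcome Goal : Set
    Outcome = List PAtom
    Goal    = List Outcome

    outcomes : List Outcome
    outcomes = sublists (atoms ψ)

    _holds-in_ : PAtom → Outcome → Bool
    a holds-in l = does (a ∈? l)

    describe : Outcome → List PAtom → Boolean PAtom
    describe l []       = ttᵇ
    describe l (a ∷ as) = (if a holds-in l then posᵇ a else negᵇ a) ∧ᵇ describe l as

    one-of : Goal → Boolean PAtom
    one-of []      = ffᵇ
    one-of (l ∷ Q) = describe l (atoms ψ) ∨ᵇ one-of Q

    describe-atoms : ∀ l as {a} → a ∈ atomsᵇ (describe l as) → a ∈ as
    describe-atoms l (b ∷ as) a∈ with b holds-in l
    describe-atoms l (b ∷ as) (here refl) | true  = here refl
    describe-atoms l (b ∷ as) (there a∈)  | true  = there (describe-atoms l as a∈)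
    describe-atoms l (b ∷ as) (here refl) | false = here refl
    describe-atoms l (b ∷ as) (there a∈)  | false = there (describe-atoms l as a∈)

    one-of-atoms : ∀ Q {a} → a ∈ atomsᵇ (one-of Q) → a ∈ atoms ψ
    one-of-atoms (l ∷ Q) a∈ with ∈-++⁻ (atomsᵇ (describe l (atoms ψ))) a∈
    ... | inj₁ a∈l = describe-atoms l (atoms ψ) a∈l
    ... | inj₂ a∈Q = one-of-atoms Q a∈Q

    Matches : (PAtom → Bool) → Outcome → List PAtom → Set
    Matches τ l as = ∀ a → a ∈ as → τ a ≡ a holds-in l

    evaluate-describe : ∀ τ l as → T (evaluate τ (describe l as)) ⇔ Matches τ l as
    evaluate-describe τ l []       = mk⇔ (λ _ _ ()) (λ _ → tt)
    evaluate-describe τ l (b ∷ as) = mk⇔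
      (λ t → let here-true , there-true = to (T-∧ {literal}) t in λ
        { _ (here refl) → to sign here-true
        ; a (there a∈)  → to (evaluate-describe τ l as) there-true a a∈ })
      (λ h → from (T-∧ {literal})
        ( from sign (h b (here refl))
        , from (evaluate-describe τ l as) (λ a a∈ → h a (there a∈))))
      where
      literal = evaluate τ (if b holds-in l then posᵇ b else negᵇ b)
      sign : T literal ⇔ (τ b ≡ b holds-in l)
      sign with b holds-in l
      ... | true  = T-≡
      ... | false with τ b
      ...   | true  = mk⇔ (λ ()) (λ ())
      ...   | false = mk⇔ (λ _ → refl) (λ _ → tt)

    evaluate-one-of : ∀ τ Q → T (evaluate τ (one-of Q)) ⇔
                      (∃[ l ] (l ∈ Q × Matches τ l (atoms ψ)))
    evaluate-one-of τ []      = mk⇔ (λ ()) (λ { (_ , () , _) })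
    evaluate-one-of τ (l ∷ Q) = mk⇔ (forward ∘ to (T-∨ {first})) (from (T-∨ {first}) ∘ backward)
      where
      first = evaluate τ (describe l (atoms ψ))
      forward : T first ⊎ T (evaluate τ (one-of Q)) → _
      forward (inj₁ t) = l , here refl , to (evaluate-describe τ l (atoms ψ)) t
      forward (inj₂ t) = let m , m∈ , h = to (evaluate-one-of τ Q) t in m , there m∈ , h
      backward : _ → T first ⊎ T (evaluate τ (one-of Q))
      backward (m , here refl , h) = inj₁ (from (evaluate-describe τ l (atoms ψ)) h)
      backward (m , there m∈ , h)  = inj₂ (from (evaluate-one-of τ Q) (m , m∈ , h))

    -- A structure matters to the game only through the sets Q of outcomes
    -- that the agent can force, so in each round the agent may as well pick one
    -- of these sets, and the environment an outcome in it.
    winning : List Goal → ℕ → Label → Bool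
    winning 𝒢 zero    s = does (final? s)
    winning 𝒢 (suc i) s =
      winning 𝒢 i s ∨ any (all (λ l → winning 𝒢 i (progress (atoms ψ) (_holds-in l) s))) 𝒢

    answered : ∀ {Γ} → (∀ {s} → s ∈ X → s ∈ Γ) → ∀ {s} → Variable s → s ∈ Y ++ Γ
    answered r (current x)  = [ ∈-++⁺ʳ Y ∘ r , ∈-++⁺ˡ ]′ (∈-++⁻ X x)
    answered r (lookback x) = [ ∈-++⁺ʳ Y ∘ r , ∈-++⁺ˡ ]′ (∈-++⁻ X x)

    -- Every goal gets its own copy of Y under the shared X, since answers to different goals are
    -- unrelated. The accumulator φ carries the conditions so far past each new block, which keeps
    -- all quantifiers in front of the matrix.
    attain : ∀ {Γ} → List Goal → (∀ {s} → s ∈ X → s ∈ Γ) → Formula Γ → Formula Γ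
    attain []      r φ = φ
    attain (Q ∷ 𝒢) r φ = ∃[ Y ]′ (attain 𝒢 (∈-++⁺ʳ Y ∘ r)
      (rename (∈-++⁺ʳ Y) φ ∧′ toFormula (answered r) (one-of Q)))

    attainable : List Goal → Sentence
    attainable 𝒢 = ∀[ X ] (attain 𝒢 ∈-++⁺ˡ ⊤′)

    attain-∃* : ∀ {Γ} 𝒢 (r : ∀ {s} → s ∈ X → s ∈ Γ) φ → QuantifierFree φ → ∃* (attain 𝒢 r φ)
    attain-∃* []      r φ qf = matrix qf
    attain-∃* (Q ∷ 𝒢) r φ qf = ∃*-∃[] Y _ (attain-∃* 𝒢 (∈-++⁺ʳ Y ∘ r) _
      (QuantifierFree-rename (∈-++⁺ʳ Y) φ qf , QuantifierFree-toFormula (answered r) (one-of Q)))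

    attainable-∀*∃* : ∀ 𝒢 → ∀*∃* (attainable 𝒢)
    attainable-∀*∃* 𝒢 = ∀*∃*-∀[] X _ (∃-part (attain-∃* 𝒢 ∈-++⁺ˡ ⊤′ tt))

    module _ (ψ-free : LookbackFree ψ) (em : {P : Set} → Dec P) (M : Structure) where
      open Structure M

      τ : Env M X → Env M Y → PAtom → Bool
      τ = σ M em ψ ψ-free

      Forces : Env M X → Goal → Set
      Forces β Q = ∃[ γ ] T (evaluate (τ β γ) (one-of Q))

      lookup-answered : ∀ {Γ} (r : ∀ {s} → s ∈ X → s ∈ Γ) (ρ : Env M Γ) β γ →
        (∀ {s} (x : s ∈ X) → All.lookup ρ (r x) ≡ All.lookup β x) →
        ∀ {s} (x : Variable s) → T (is-current x) →
        All.lookup (++⁺ γ ρ) (answered r x) ≡ present M em ψ ψ-free (++⁺ β γ) x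
      lookup-answered r ρ β γ h (current x) _ with ∈-++⁻ X x | ++⁺∘++⁻ X x
      ... | inj₁ x∈X | refl =
        trans (lookup-++⁺ʳ M γ ρ (r x∈X)) (trans (h x∈X) (sym (lookup-++⁺ˡ M β γ x∈X)))
      ... | inj₂ y∈Y | refl =
        trans (lookup-++⁺ˡ M γ ρ y∈Y) (sym (lookup-++⁺ʳ M β γ y∈Y))

      attain-correct : ∀ {Γ} 𝒢 (r : ∀ {s} → s ∈ X → s ∈ Γ) φ (ρ : Env M Γ) β →
        (∀ {s} (x : s ∈ X) → All.lookup ρ (r x) ≡ All.lookup β x) →
        _⊨_ M ρ (attain 𝒢 r φ) ⇔ (_⊨_ M ρ φ × All (Forces β) 𝒢)
      attain-correct []      r φ ρ β h = mk⇔ (λ v → v , []) proj₁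
      attain-correct (Q ∷ 𝒢) r φ ρ β h = mk⇔
        (λ { (γ , (v , t) , rest) → v , (γ , t) ∷ rest })
        (λ { (v , (γ , t) ∷ rest) → γ , (v , t) , rest })
        ⇔-∘ (mk⇔ (λ (γ , v) → γ , to (inner γ) v) (λ (γ , v) → γ , from (inner γ) v)
        ⇔-∘ ⊨-∃[] M Y ρ (attain 𝒢 r′ φ′))
        where
        r′ : ∀ {s} → s ∈ X → s ∈ Y ++ _
        r′ = ∈-++⁺ʳ Y ∘ r
        φ′ = rename (∈-++⁺ʳ Y) φ ∧′ toFormula (answered r) (one-of Q)
        inner : ∀ γ → _⊨_ M (++⁺ γ ρ) (attain 𝒢 r′ φ′) ⇔
                ((_⊨_ M ρ φ × T (evaluate (τ β γ) (one-of Q))) × All (Forces β) 𝒢)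
        inner γ =
          ((⊨-rename M (∈-++⁺ʳ Y) {ρ} {++⁺ γ ρ} (lookup-++⁺ʳ M γ ρ) φ ×-⇔
            toFormula-evaluate M em ψ ψ-free (answered r) (++⁺ γ ρ) (++⁺ β γ) is-current
              (lookup-answered r ρ β γ h) (one-of Q) (λ a∈ → All.lookup ψ-free (one-of-atoms Q a∈)))
           ×-⇔ ⇔-id _)
          ⇔-∘ attain-correct 𝒢 r′ φ′ (++⁺ γ ρ) β (λ x → trans (lookup-++⁺ʳ M γ ρ (r x)) (h x))

      attainable-correct : ∀ 𝒢 → _⊨_ M [] (attainable 𝒢) ⇔ (∀ β → All (Forces β) 𝒢)
      attainable-correct 𝒢 = mk⇔
        (λ v β → proj₂ (to (inner β) (v β)))
        (λ f β → from (inner β) (tt , f β))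
        ⇔-∘ ⊨-∀[] M X [] _
        where
        inner : ∀ β → _⊨_ M (++⁺ β []) (attain 𝒢 ∈-++⁺ˡ ⊤′) ⇔ (⊤ × All (Forces β) 𝒢)
        inner β = attain-correct 𝒢 ∈-++⁺ˡ ⊤′ (++⁺ β []) β (lookup-++⁺ˡ M β [])

      winning-sound : ∀ {𝒢} → (∀ β → All (Forces β) 𝒢) →
                      ∀ i s → T (winning 𝒢 i s) → W M em ψ ψ-free i s
      winning-sound forces zero    s t = to (T-does (final? s)) t
      winning-sound {𝒢} forces (suc i) s t with to (T-∨ {winning 𝒢 i s}) t
      ... | inj₁ t′ = inj₁ (winning-sound forces i s t′)
      ... | inj₂ t′ with find (any⁻ _ 𝒢 t′)
      ...   | Q , Q∈𝒢 , all-win = inj₂ λ β →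
        let γ , reached       = All.lookup (forces β) Q∈𝒢
            l , l∈Q , matches = to (evaluate-one-of (τ β γ) Q) reached
        in γ , Wins-resp (atoms ψ) τ i (progress-cong-atoms s (λ {a} a∈ → sym (matches a a∈)))
                 (winning-sound forces i _ (All.lookup (all⁺ _ Q all-win) l∈Q))

      -- The candidate that the completeness proof uses for M. It takes excluded middle to single
      -- out, which is why the procedure searches through all candidates.
      achievable : List Goal
      achievable = filter (λ Q → em {∀ β → Forces β Q}) (sublists outcomes)

      winning-complete : ∀ i s → W M em ψ ψ-free i s → T (winning achievable i s)
      winning-complete zero    s w = from (T-does (final? s)) w
      winning-complete (suc i) s (inj₁ w) = from T-∨ (inj₁ (winning-complete i s w))
      winning-complete (suc i) s (inj₂ w) = from (T-∨ {winning achievable i s})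
        (inj₂ (any⁺ _ (lose Q∈ (all⁻ _ (All.tabulate λ l∈ →
          proj₂ (∈-filter⁻ good? {xs = outcomes} l∈))))))
        where
        good? : ∀ l → Dec (T (winning achievable i (progress (atoms ψ) (_holds-in l) s)))
        good? l = T? _
        -- The goal to force is the set of all outcomes after which the agent wins in i rounds; a
        -- winning answer to β always lands in it.
        Q = filter good? outcomes
        outcome : (PAtom → Bool) → Outcome
        outcome τ = filter (λ a → T? (τ a)) (atoms ψ)
        matches : ∀ τ → Matches τ (outcome τ) (atoms ψ)
        matches τ a a∈ with τ a in eq
        ... | true  = sym (dec-true (a ∈? outcome τ)
                        (∈-filter⁺ (λ a → T? (τ a)) a∈ (from T-≡ eq)))
        ... | false = sym (dec-false (a ∈? outcome τ) λ a∈l →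
                        subst T eq (proj₂ (∈-filter⁻ (λ a → T? (τ a)) {xs = atoms ψ} a∈l)))
        forced : ∀ β → Forces β Q
        forced β =
          let γ , w′ = w β
              l      = outcome (τ β γ)
          in γ , from (evaluate-one-of (τ β γ) Q)
            ( l
            , ∈-filter⁺ good? (filter∈sublists (λ a → T? (τ β γ a)) (atoms ψ))
                (winning-complete i _
                  (Wins-resp (atoms ψ) τ i (progress-cong-atoms s (λ {a} → matches (τ β γ) a)) w′))
            , matches (τ β γ))
        Q∈ : Q ∈ achievable
        Q∈ = ∈-filter⁺ (λ Q → em) (filter∈sublists good? outcomes) forced

  WinStableAt-bound : Classical → ∀ ψ → LookbackFree ψ → WinStableAt ψ (bound (s₀ ψ))
  WinStableAt-bound em ψ ψ-free M ρ i v =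
    from (Win-Wins M (classical₀ em) ψ ψ-free (bound (s₀ ψ)) ρ (s₀ ψ))
      (W-stable M (classical₀ em) ψ ψ-free i
        (to (Win-Wins M (classical₀ em) ψ ψ-free i ρ (s₀ ψ)) v))

  RealizableIn⇒Win : Classical → ∀ ψ → LookbackFree ψ → ∀ K → WinStableAt ψ K →
                     ∀ M → Semantics.RealizableIn M ψ → Satisfies M (Win ψ K (s₀ ψ))
  RealizableIn⇒Win em ψ ψ-free K stable M realizable = ρ ,
    stable M ρ (bound (s₀ ψ)) (from (Win-Wins M (classical₀ em) ψ ψ-free (bound (s₀ ψ)) ρ (s₀ ψ))
      (RealizableIn⇒W M (classical₀ em) ψ ψ-free realizable))
    where
    ρ : Env M V
    ρ = All.universal (Structure.inhabited M) V

  Win⇒GRealizesIn : Classical → ∀ ψ → LookbackFree ψ → ∀ K →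
                    ∀ M → Satisfies M (Win ψ K (s₀ ψ)) → GRealizesIn ψ M K
  Win⇒GRealizesIn em ψ ψ-free K M (ρ , v) =
    W⇒GRealizesIn M (classical₀ em) ψ ψ-free K
      (to (Win-Wins M (classical₀ em) ψ ψ-free K ρ (s₀ ψ)) v)

  GRealizesIn⇒RealizableIn : ∀ ψ K M → GRealizesIn ψ M K → Semantics.RealizableIn M ψ
  GRealizesIn⇒RealizableIn ψ K M ((g , isG) , realizes) = g , realizes g isG

  module _ (𝒯 : Theory) (sat : Decidable {A = Σ Sentence ∀*∃*} (λ (φ , _) → Satisfiable 𝒯 φ)) where

    suitable : (ψ : Property) → List (Goal ψ) → Bool
    suitable ψ 𝒢 = winning ψ 𝒢 (bound (s₀ ψ)) (s₀ ψ) ∧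
                   proj₁ sat (attainable ψ 𝒢 , attainable-∀*∃* ψ 𝒢)

    realizable? : Property → Bool
    realizable? ψ = any (suitable ψ) (sublists (sublists (outcomes ψ)))

    module _ (em : Classical) (ψ : Property) (ψ-free : LookbackFree ψ) where

      sat-correct : ∀ 𝒢 → T (proj₁ sat (attainable ψ 𝒢 , attainable-∀*∃* ψ 𝒢)) ⇔
                          Satisfiable 𝒯 (attainable ψ 𝒢)
      sat-correct 𝒢 with proj₁ sat (attainable ψ 𝒢 , attainable-∀*∃* ψ 𝒢)
                       | proj₂ sat em (attainable ψ 𝒢 , attainable-∀*∃* ψ 𝒢)
      ... | true  | ofʸ yes-sat = mk⇔ (λ _ → yes-sat) (λ _ → tt)
      ... | false | ofⁿ no-sat  = mk⇔ (λ ()) no-sat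

      realizable?-sound : T (realizable? ψ) → Realizable 𝒯 ψ
      realizable?-sound t with find (any⁻ (suitable ψ) (sublists (sublists (outcomes ψ))) t)
      ... | 𝒢 , _ , suits with to (T-∧ {winning ψ 𝒢 (bound (s₀ ψ)) (s₀ ψ)}) suits
      ...   | wins , satisfiable with to (sat-correct 𝒢) satisfiable
      ...     | M , model , [] , v = M , model ,
        GRealizesIn⇒RealizableIn ψ (bound (s₀ ψ)) M
          (W⇒GRealizesIn M (classical₀ em) ψ ψ-free (bound (s₀ ψ))
            (winning-sound ψ ψ-free (classical₀ em) M
              (to (attainable-correct ψ ψ-free (classical₀ em) M 𝒢) v) (bound (s₀ ψ)) (s₀ ψ) wins))

      realizable?-complete : Realizable 𝒯 ψ → T (realizable? ψ)
      realizable?-complete (M , model , realizable) =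
        any⁺ (suitable ψ) (lose (filter∈sublists _ (sublists (outcomes ψ)))
          (from (T-∧ {winning ψ 𝒢 (bound (s₀ ψ)) (s₀ ψ)})
            ( winning-complete ψ ψ-free (classical₀ em) M (bound (s₀ ψ)) (s₀ ψ)
                (RealizableIn⇒W M (classical₀ em) ψ ψ-free realizable)
            , from (sat-correct 𝒢) (M , model , [] ,
                from (attainable-correct ψ ψ-free (classical₀ em) M 𝒢)
                  (λ β → All.tabulate λ Q∈ →
                    proj₂ (∈-filter⁻ (λ Q → classical₀ em) {xs = sublists (outcomes ψ)} Q∈) β)))))
        where
        𝒢 = achievable ψ ψ-free (classical₀ em) M

theorem3 : (S : Signature) (X Y : List (Signature.Sort S)) → X ++ Y ≢ [] →
    (D : Properties.Decomposition S X Y) →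
    let open Synthesis S X Y D in
    (𝒯 : Theory) →
    Decidable {A = Σ Sentence ∀*∃*} (λ (φ , _) → Satisfiable 𝒯 φ) →
    Solvable 𝒯 LookbackFree ×
    (Classical → ∀ ψ → LookbackFree ψ → ∀ K → WinStableAt ψ K →
    Realizable 𝒯 ψ ⇔ Satisfiable 𝒯 (Win ψ K (s₀ ψ)))
theorem3 S X Y _ D 𝒯 sat =
  record
    { decidable   = (λ (ψ , _) → realizable? 𝒯 sat ψ) , λ em (ψ , ψ-free) →
        fromEquivalence (realizable?-sound 𝒯 sat em ψ ψ-free)
                        (realizable?-complete 𝒯 sat em ψ ψ-free)
    ; win-defined = λ em ψ ψ-free → bound (s₀ ψ) , WinStableAt-bound em ψ ψ-free
    ; g-defined   = λ em ψ ψ-free K stable M _ → RealizableIn⇒Win em ψ ψ-free K stable M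
    ; g-realizes  = λ em ψ ψ-free K _ M _ → Win⇒GRealizesIn em ψ ψ-free K M
    } ,
  λ em ψ ψ-free K stable → mk⇔
    (λ (M , model , realizable) → M , model , RealizableIn⇒Win em ψ ψ-free K stable M realizable)
    (λ (M , model , satisfied) → M , model ,
       GRealizesIn⇒RealizableIn ψ K M (Win⇒GRealizesIn em ψ ψ-free K M satisfied))
  where
  open Synthesis S X Y D
  open Deciding S X Y D
  open Game patom-dec using (bound)
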